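{- Let $n,a,b$ be positive integers, $c$ a nonnegative integer and $0\le k\le n$ an integer. Then $$\Psi_n(k,a,b,c)=\binom{n}{k}M_n(a,b,c)\prod_{j=1}^{k}\frac{a-1+(n-j)\frac c2}{b+(j-1)\frac c2}.$$
   Context: All constant terms are taken with $\operatorname{CT}_x=\operatorname{CT}_{x_n}\cdots\operatorname{CT}_{x_1}$ (iterated constant-term extraction), where $(1-x_i)^{ -b}$ and $x_i/(1-x_i)$ are expanded as power series in $x_i$, and for $i<j$, $(x_j-x_i)^{ -c}=x_j^{ -c}(1-x_i/x_j)^{ -c}$ is expanded as a power series in $x_i/x_j$. $$M_n(a,b,c):=\operatorname{CT}_x\prod_{i=1}^n(1-x_i)^{ -b}x_i^{ -a+1}\prod_{1\le i<j\le n}(x_j-x_i)^{ -c},$$ $$\Psi_n(k,a,b,c):=\operatorname{CT}_x[t^k]\prod_{i=1}^n(1-x_i)^{ -b}x_i^{ -a+1}\Big(1+t\frac{x_i}{1-x_i}\Big)\prod_{1\le i<j\le n}(x_j-x_i)^{ -c},$$ with $[t^k]$ denoting the coefficient of $t^k$. -}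

module Defs where

open import Level using (0ℓ)
open import Algebra.Bundles using (RawRing)
import Algebra.Definitions.RawSemiring as RawSemiringOps
open import Data.Nat.Base as ℕ using (ℕ; zero; suc; s≤s)
open import Data.Integer.Base as ℤ using (ℤ; +_; -[1+_]; 0ℤ; 1ℤ)
open import Data.Rational.Base as ℚ using (ℚ; _÷_; ½)
open import Data.Rational.Properties
  using (normalize-pos; normalize-nonNeg; pos+nonNeg⇒pos; nonNeg*nonNeg⇒nonNeg; pos⇒nonZero)
open import Data.Fin.Base using (Fin; zero; suc; toℕ; _<_)
open import Data.Fin.Properties using (_<?_)
open import Relation.Nullary using (yes; no)

-- ⟨ d , f ⟩ is the formal Laurent series Σ_{m ≥ 0} f m · x^(d + m).
-- The presentation is not unique (f 0 may vanish): two series are equal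
-- when all their coefficients agree.

record Laurent (A : Set) : Set where
  constructor ⟨_,_⟩
  field
    ord    : ℤ
    coeffs : ℕ → A

open Laurent public

module _ (R : RawRing 0ℓ 0ℓ) where
  open RawRing R
  open RawSemiringOps rawSemiring using (sum)

  private
    at : ℤ → (ℕ → Carrier) → Carrier
    at (+ m)    f = f m
    at -[1+ _ ] f = 0#

  coeff : ℤ → Laurent Carrier → Carrier
  coeff e s = at (e ℤ.- ord s) (coeffs s)

  constantTail : Carrier → ℕ → Carrier
  constantTail c zero    = c
  constantTail c (suc _) = 0#

  const : Carrier → Laurent Carrier
  const c = ⟨ 0ℤ , constantTail c ⟩

  monomial : ℤ → Laurent Carrier
  monomial d = ⟨ d , constantTail 1# ⟩

  laurentRing : RawRing 0ℓ 0ℓ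
  laurentRing = record
    { Carrier = Laurent Carrier
    ; _≈_     = λ s u → ∀ e → coeff e s ≈ coeff e u
    ; _+_     = λ s u → let d = ord s ℤ.⊓ ord u in
                  ⟨ d , (λ m → coeff (d ℤ.+ + m) s + coeff (d ℤ.+ + m) u) ⟩
    ; _*_     = λ s u →
                  ⟨ ord s ℤ.+ ord u
                  , (λ m → sum {suc m} (λ i → coeffs s (toℕ i) * coeffs u (m ℕ.∸ toℕ i))) ⟩
    ; -_      = λ s → ⟨ ord s , (λ m → - coeffs s m) ⟩
    ; 0#      = const 0#
    ; 1#      = const 1#
    }

-- The iterated Laurent series ring ℚ((xₙ))⋯((x₁)).  The variable with index
-- zero : Fin n is x₁, the outermost one.  In this ring (x_j - x_i)⁻¹ for i < j
-- is the series in nonnegative powers of x_i / x_j.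

L : ℕ → RawRing 0ℓ 0ℓ
L zero    = ℚ.+-*-rawRing
L (suc n) = laurentRing (L n)

Series : ℕ → Set
Series n = RawRing.Carrier (L n)

-- CT_{xₙ} ⋯ CT_{x₁}, with CT_{x₁} applied first.

CT : ∀ n → Series n → ℚ
CT zero    s = s
CT (suc n) s = CT n (coeff (L n) 0ℤ s)

varPow : ∀ {n} → Fin n → ℤ → Series n
varPow {suc n} zero    d = monomial (L n) d
varPow {suc n} (suc i) d = const (L n) (varPow i d)

-- (1 - x_i)⁻¹ = Σ_{m ≥ 0} x_i^m

geom : ∀ {n} → Fin n → Series n
geom {suc n} zero    = ⟨ 0ℤ , (λ _ → RawRing.1# (L n)) ⟩
geom {suc n} (suc i) = const (L n) (geom i)

-- (1 - x_i / x_j)⁻¹ = Σ_{m ≥ 0} x_j^(-m) · x_i^m   for i < j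

geomRatio : ∀ {n} (i j : Fin n) → i < j → Series n
geomRatio {suc n} zero    (suc j) _         = ⟨ 0ℤ , (λ m → varPow j (ℤ.- + m)) ⟩
geomRatio {suc n} (suc i) (suc j) (s≤s i<j) = const (L n) (geomRatio i j i<j)

module _ (n : ℕ) where
  open RawRing (L n)
  open RawSemiringOps rawSemiring using (_^_; product)

  -- (1 - x_i)^(-b) · x_i^(-a+1)
  vertexFactor : (a b : ℕ) → Fin n → Series n
  vertexFactor a b i = geom i ^ b * varPow i (ℤ.- + a ℤ.+ 1ℤ)

  -- x_i / (1 - x_i)
  x/[1-x] : Fin n → Series n
  x/[1-x] i = varPow i 1ℤ * geom i

  -- (x_j - x_i)^(-c) if i < j, and 1 otherwise
  edgeFactor : (c : ℕ) (i j : Fin n) → Series n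
  edgeFactor c i j with i <? j
  ... | yes i<j = varPow j (ℤ.- + c) * geomRatio i j i<j ^ c
  ... | no  _   = 1#

  edgeProduct : ℕ → Series n
  edgeProduct c = product (λ i → product (λ j → edgeFactor c i j))

M : (n a b c : ℕ) → ℚ
M n a b c = CT n (product (vertexFactor n a b) * edgeProduct n c)
  where
  open RawRing (L n)
  open RawSemiringOps rawSemiring using (product)

-- t is adjoined as one further Laurent variable over L n; the integrand is a
-- polynomial in t, and [t^k] is taken before CT.

Ψ : (n k a b c : ℕ) → ℚ
Ψ n k a b c =
  CT n (coeff (L n) (+ k)
    (product (λ i → ι (vertexFactor n a b i) * (1# + t * ι (x/[1-x] n i)))
      * ι (edgeProduct n c)))
  where
  open RawRing (laurentRing (L n))
  open RawSemiringOps rawSemiring using (product)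

  ι : Series n → Carrier
  ι = const (L n)

  t : Carrier
  t = monomial (L n) 1ℤ

fromℕ : ℕ → ℚ
fromℕ m = + m ℚ./ 1

numerator : (n a c j : ℕ) → ℚ
numerator n a c j =
  (fromℕ a ℚ.- fromℕ 1) ℚ.+ (fromℕ n ℚ.- fromℕ j) ℚ.* (fromℕ c ℚ.* ½)

-- The argument j′ stands for j - 1.
denominator : (b c j′ : ℕ) → ℚ
denominator b c j′ = fromℕ b ℚ.+ fromℕ j′ ℚ.* (fromℕ c ℚ.* ½)

denominator-nonZero : ∀ b c j′ .{{_ : ℕ.NonZero b}} → ℚ.NonZero (denominator b c j′)
denominator-nonZero b c j′ =
  pos⇒nonZero (denominator b c j′) {{pos+nonNeg⇒pos (fromℕ b) {{normalize-pos b 1}} _ {{summand≥0}}}}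
  where
  c/2≥0 : ℚ.NonNegative (fromℕ c ℚ.* ½)
  c/2≥0 = nonNeg*nonNeg⇒nonNeg (fromℕ c) {{normalize-nonNeg c 1}} ½

  summand≥0 : ℚ.NonNegative (fromℕ j′ ℚ.* (fromℕ c ℚ.* ½))
  summand≥0 = nonNeg*nonNeg⇒nonNeg (fromℕ j′) {{normalize-nonNeg j′ 1}} _ {{c/2≥0}}

-- ∏_{j=1}^{k} (a - 1 + (n - j) c/2) / (b + (j - 1) c/2), with j = suc (toℕ j′)

ratioProduct : (n k a b c : ℕ) .{{_ : ℕ.NonZero b}} → ℚ
ratioProduct n k a b c = product {k} λ j′ →
  (numerator n a c (suc (toℕ j′)) ÷ denominator b c (toℕ j′))
    {{denominator-nonZero b c (toℕ j′)}}
  where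
  open RawSemiringOps (RawRing.rawSemiring ℚ.+-*-rawRing) using (product)

{-# OPTIONS --safe #-}
module Submission where

-- The constant term of a total derivative x_k ∂/∂x_k (…) vanishes.  Let F be the
-- integrand of M, y_k = x_k / (1 - x_k), G = F · ∏ (1 + t y_i), h_k = 1 / (1 + t y_k),
-- and apply this to Σ_k x_k ∂/∂x_k (h_k G).  The logarithmic derivative of F is
-- b y_k - (a - 1) - c Σ_{j ≠ k} x_k / (x_k - x_j); after multiplication by h_k and
-- summation over k the terms for (k , j) and (j , k) combine into
-- h_k h_j (1 - t y_k y_j), free of the denominator x_k - x_j.  The sum is then an
-- expression in G and t ∂/∂t, and its coefficient at t^k gives
-- (k + 1) (b + k c/2) Ψ_{k+1} = (n - k) (a - 1 + (n - k - 1) c/2) Ψ_k.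

open import Defs
open import Level using (0ℓ)
open import Algebra.Bundles using (CommutativeRing; RawRing)
open import Algebra.Structures using (IsCommutativeRing)
open import Data.Fin.Base using (Fin; zero; suc; toℕ; _<_)
open import Data.Fin.Properties using (_<?_; <-cmp; toℕ-inject₁; toℕ-fromℕ)
open import Data.Integer.Base as ℤ using (ℤ; +_; -[1+_]; 0ℤ; 1ℤ)
import Data.Integer.Properties as ℤₚ
import Data.Integer.Solver as ℤSolver
import Data.Maybe.Base as Maybe
open import Data.Nat.Base as ℕ using (ℕ; zero; suc; s≤s; z≤n; NonZero; _≤_)
open import Data.Nat.Combinatorics using (_C_; nC1≡n; nCn≡1; nCk≡nC[n∸k]; nCk+nC[k+1]≡[n+1]C[k+1])
import Data.Nat.Properties as ℕₚ
import Data.Nat.Solver as ℕSolver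
open import Data.Product.Base using (_,_)
open import Data.Rational.Base as ℚ using (ℚ; 0ℚ; 1ℚ; ½; _÷_; 1/_)
import Data.Rational.Properties as ℚₚ
import Data.Rational.Unnormalised.Base as ℚᵘ
import Data.Rational.Unnormalised.Properties as ℚᵘₚ
open import Function.Base using (_∘_)
open import Relation.Binary.Consequences using (dec⇒weaklyDec)
open import Relation.Binary.Definitions using (tri<; tri≈; tri>)
open import Relation.Binary.PropositionalEquality as ≡ using (_≡_)
open import Relation.Nullary using (¬_; yes; no; contradiction)

-- Rings, sums and derivations

-- The sum closes up in G because `u_i = t y_i h_i` equals `1 - h_i`. After multiplication by t,
-- every term is a polynomial in t, n, E = sum of the u_i and U² = sum of the u_i². With T = t ∂/∂t
-- one has E G = T G, and T u_i = u_i (1 - u_i) gives T (T G) = (E - U² + E²) G. As E² and U² occur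
-- only through E² - U², both sums can be traded for T G and T (T G). On the coefficient of t^k the
-- operator T is the scalar k and multiplication by t is a shift, so a two-term recurrence remains.
-- Its c/2 comes from symmetrising: the double sum over (k , j) meets each pair twice. The obstacle
-- is that series over a ring cannot be divided at will. Reciprocals are therefore explicit
-- geometric series together with the equation that they satisfy. The algebra runs over two abstract
-- commutative rings with just such equations as data; iterated Laurent series only supply the data,
-- and the order of the variables decides how 1 / (x_i - x_j) is expanded.

module IntegerSolver (R : CommutativeRing 0ℓ 0ℓ) where
  open CommutativeRing R hiding (zero)
  open import Algebra.Properties.Ring ring
  open import Algebra.Properties.AbelianGroup +-abelianGroup
  open import Algebra.Properties.Semiring.Mult.TCOptimised semiring
  open import Algebra.Properties.CommutativeSemigroup +-commutativeSemigroup using (interchange)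
  open import Algebra.Solver.Ring.AlmostCommutativeRing
    using (fromCommutativeRing; _-Raw-AlmostCommutative⟶_)
  open import Relation.Binary.Reasoning.Setoid setoid

  -- The canonical ring map from the integers. Equality of series is not decidable, so the ring
  -- solver compares coefficients in ℤ and sends them through this map; the exponents b, 1 - a, c
  -- enter every ring in the same way. With this variant of `×`, `⟦ 1ℤ ⟧ᶻ` computes to `1#`.
  ⟦_⟧ᶻ : ℤ → Carrier
  ⟦ + n ⟧ᶻ      = n × 1#
  ⟦ -[1+ n ] ⟧ᶻ = - (suc n × 1#)

  ⟦⊖⟧ : ∀ m n → ⟦ m ℤ.⊖ n ⟧ᶻ ≈ m × 1# - n × 1#
  ⟦⊖⟧ zero zero = sym (-‿inverseʳ 0#)
  ⟦⊖⟧ zero (suc n) = sym (+-identityˡ _)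
  ⟦⊖⟧ (suc m) zero = sym (trans (+-congˡ ε⁻¹≈ε) (+-identityʳ _))
  ⟦⊖⟧ (suc m) (suc n) = begin
    ⟦ suc m ℤ.⊖ suc n ⟧ᶻ           ≡⟨ ≡.cong ⟦_⟧ᶻ (ℤₚ.[1+m]⊖[1+n]≡m⊖n m n) ⟩
    ⟦ m ℤ.⊖ n ⟧ᶻ                   ≈⟨ ⟦⊖⟧ m n ⟩
    m × 1# - n × 1#                ≈⟨ +-identityˡ _ ⟨
    0# + (m × 1# - n × 1#)         ≈⟨ +-congʳ (-‿inverseʳ 1#) ⟨
    1# - 1# + (m × 1# - n × 1#)    ≈⟨ interchange _ _ _ _ ⟩
    1# + m × 1# + (- 1# - n × 1#)  ≈⟨ +-cong (sym (1+× m 1#)) (⁻¹-∙-comm _ _) ⟩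
    suc m × 1# - (1# + n × 1#)     ≈⟨ +-congˡ (-‿cong (1+× n 1#)) ⟨
    suc m × 1# - suc n × 1#        ∎

  ⟦+⟧ : ∀ p q → ⟦ p ℤ.+ q ⟧ᶻ ≈ ⟦ p ⟧ᶻ + ⟦ q ⟧ᶻ
  ⟦+⟧ (+ m)      (+ n)      = ×-homo-+ 1# m n
  ⟦+⟧ (+ m)      (-[1+ n ]) = ⟦⊖⟧ m (suc n)
  ⟦+⟧ (-[1+ m ]) (+ n)      = trans (⟦⊖⟧ n (suc m)) (+-comm _ _)
  ⟦+⟧ (-[1+ m ]) (-[1+ n ]) = begin
    - (suc (suc (m ℕ.+ n)) × 1#)     ≡⟨ ≡.cong (λ k → - (k × 1#)) (ℕₚ.+-suc (suc m) n) ⟨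
    - ((suc m ℕ.+ suc n) × 1#)       ≈⟨ -‿cong (×-homo-+ 1# (suc m) (suc n)) ⟩
    - (suc m × 1# + suc n × 1#)      ≈⟨ ⁻¹-∙-comm _ _ ⟨
    - (suc m × 1#) - suc n × 1#      ∎

  ⟦-⟧ : ∀ p → ⟦ ℤ.- p ⟧ᶻ ≈ - ⟦ p ⟧ᶻ
  ⟦-⟧ (+ zero)  = sym ε⁻¹≈ε
  ⟦-⟧ (+ suc n) = refl
  ⟦-⟧ -[1+ n ]  = sym (⁻¹-involutive _)

  ⟦+*⟧ : ∀ m q → ⟦ + m ℤ.* q ⟧ᶻ ≈ m × 1# * ⟦ q ⟧ᶻ
  ⟦+*⟧ m (+ n) = begin
    ⟦ + m ℤ.* + n ⟧ᶻ  ≡⟨ ≡.cong ⟦_⟧ᶻ (ℤₚ.pos-* m n) ⟨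
    (m ℕ.* n) × 1#    ≈⟨ ×1-homo-* m n ⟩
    m × 1# * n × 1#   ∎
  ⟦+*⟧ m -[1+ n ] = begin
    ⟦ + m ℤ.* -[1+ n ] ⟧ᶻ        ≡⟨ ≡.cong ⟦_⟧ᶻ (ℤₚ.neg-distribʳ-* (+ m) (+ suc n)) ⟨
    ⟦ ℤ.- (+ m ℤ.* + suc n) ⟧ᶻ   ≈⟨ ⟦-⟧ (+ m ℤ.* + suc n) ⟩
    - ⟦ + m ℤ.* + suc n ⟧ᶻ       ≈⟨ -‿cong (⟦+*⟧ m (+ suc n)) ⟩
    - (m × 1# * suc n × 1#)      ≈⟨ -‿distribʳ-* _ _ ⟩
    m × 1# * - (suc n × 1#)      ∎

  ⟦*⟧ : ∀ p q → ⟦ p ℤ.* q ⟧ᶻ ≈ ⟦ p ⟧ᶻ * ⟦ q ⟧ᶻ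
  ⟦*⟧ (+ m) q = ⟦+*⟧ m q
  ⟦*⟧ -[1+ m ] q = begin
    ⟦ -[1+ m ] ℤ.* q ⟧ᶻ          ≡⟨ ≡.cong ⟦_⟧ᶻ (ℤₚ.neg-distribˡ-* (+ suc m) q) ⟨
    ⟦ ℤ.- (+ suc m ℤ.* q) ⟧ᶻ     ≈⟨ ⟦-⟧ (+ suc m ℤ.* q) ⟩
    - ⟦ + suc m ℤ.* q ⟧ᶻ         ≈⟨ -‿cong (⟦+*⟧ (suc m) q) ⟩
    - (suc m × 1# * ⟦ q ⟧ᶻ)      ≈⟨ -‿distribˡ-* _ _ ⟩
    - (suc m × 1#) * ⟦ q ⟧ᶻ      ∎

  morphism : ℤ.+-*-rawRing -Raw-AlmostCommutative⟶ fromCommutativeRing R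
  morphism = record
    { ⟦_⟧ = ⟦_⟧ᶻ ; +-homo = ⟦+⟧ ; *-homo = ⟦*⟧ ; -‿homo = ⟦-⟧
    ; 0-homo = refl ; 1-homo = refl }

  open import Algebra.Solver.Ring ℤ.+-*-rawRing (fromCommutativeRing R) morphism
    (λ p q → Maybe.map (λ p≡q → reflexive (≡.cong ⟦_⟧ᶻ p≡q)) (dec⇒weaklyDec ℤₚ._≟_ p q)) public
    using (solve; _:=_; _:+_; _:*_; _:-_; :-_; con; _:^_)

module AdditiveMaps (R S : CommutativeRing 0ℓ 0ℓ) where
  private
    module R = CommutativeRing R
    module S = CommutativeRing S
    module ΣR where
      open import Algebra.Properties.Semiring.Sum R.semiring public
      open import Algebra.Properties.Semiring.Mult.TCOptimised R.semiring public
      open IntegerSolver R public using (⟦_⟧ᶻ)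
    module ΣS where
      open import Algebra.Properties.Semiring.Sum S.semiring public
      open import Algebra.Properties.Semiring.Mult.TCOptimised S.semiring public
      open IntegerSolver S public using (⟦_⟧ᶻ)
    open import Algebra.Properties.Ring S.ring

  record IsAdditive (φ : R.Carrier → S.Carrier) : Set where
    field
      cong : ∀ {x y} → x R.≈ y → φ x S.≈ φ y
      +-homo : ∀ x y → φ (x R.+ y) S.≈ φ x S.+ φ y

    0-homo : φ R.0# S.≈ S.0#
    0-homo = x+x≈x⇒x≈0 (φ R.0#)
      (S.trans (S.sym (+-homo R.0# R.0#)) (cong (R.+-identityˡ R.0#)))

    -‿homo : ∀ x → φ (R.- x) S.≈ S.- φ x
    -‿homo x = +-inverseˡ-unique (φ (R.- x)) (φ x)
      (S.trans (S.sym (+-homo (R.- x) x)) (S.trans (cong (R.-‿inverseˡ x)) 0-homo))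

    sub-homo : ∀ x y → φ (x R.- y) S.≈ φ x S.- φ y
    sub-homo x y = S.trans (+-homo x (R.- y)) (S.+-congˡ (-‿homo y))

    sum-homo : ∀ {n} (f : Fin n → R.Carrier) → φ (ΣR.sum f) S.≈ ΣS.sum (φ ∘ f)
    sum-homo {zero}  f = 0-homo
    sum-homo {suc n} f = S.trans (+-homo _ _) (S.+-congˡ (sum-homo (f ∘ suc)))

    ×-homo : ∀ n x → φ (n ΣR.× R.1# R.* x) S.≈ n ΣS.× S.1# S.* φ x
    ×-homo zero x = S.trans (cong (R.zeroˡ x)) (S.trans 0-homo (S.sym (S.zeroˡ (φ x))))
    ×-homo (suc n) x = begin
      φ (suc n ΣR.× R.1# R.* x)
        ≈⟨ cong (R.trans (R.*-congʳ (ΣR.1+× n R.1#)) (R.trans (R.distribʳ x _ _) (R.+-congʳ (R.*-identityˡ x)))) ⟩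
      φ (x R.+ n ΣR.× R.1# R.* x)
        ≈⟨ +-homo _ _ ⟩
      φ x S.+ φ (n ΣR.× R.1# R.* x)
        ≈⟨ S.+-congˡ (×-homo n x) ⟩
      φ x S.+ n ΣS.× S.1# S.* φ x
        ≈⟨ S.trans (S.*-congʳ (ΣS.1+× n S.1#)) (S.trans (S.distribʳ (φ x) _ _) (S.+-congʳ (S.*-identityˡ (φ x)))) ⟨
      suc n ΣS.× S.1# S.* φ x  ∎
      where open import Relation.Binary.Reasoning.Setoid S.setoid

    -- Additivity alone forces linearity over ℤ. Constant-term extraction is not multiplicative, and
    -- this is what carries the integer parameters through it.
    ⟦⟧-homo : ∀ p x → φ (ΣR.⟦ p ⟧ᶻ R.* x) S.≈ ΣS.⟦ p ⟧ᶻ S.* φ x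
    ⟦⟧-homo (+ n)    x = ×-homo n x
    ⟦⟧-homo -[1+ n ] x = begin
      φ (R.- (suc n ΣR.× R.1#) R.* x)    ≈⟨ cong (RP.-‿distribˡ-* _ x) ⟨
      φ (R.- (suc n ΣR.× R.1# R.* x))    ≈⟨ -‿homo _ ⟩
      S.- φ (suc n ΣR.× R.1# R.* x)      ≈⟨ S.-‿cong (×-homo (suc n) x) ⟩
      S.- (suc n ΣS.× S.1# S.* φ x)      ≈⟨ -‿distribˡ-* _ (φ x) ⟩
      S.- (suc n ΣS.× S.1#) S.* φ x      ∎
      where
      open import Relation.Binary.Reasoning.Setoid S.setoid
      module RP where open import Algebra.Properties.Ring R.ring public

open AdditiveMaps using (IsAdditive; module IsAdditive)

module FiniteSums (R : CommutativeRing 0ℓ 0ℓ) where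
  open CommutativeRing R hiding (zero)
  open import Algebra.Properties.Semiring.Sum semiring
  open import Algebra.Properties.AbelianGroup +-abelianGroup
  open import Relation.Binary.Reasoning.Setoid setoid

  -- The recursion on both indices runs in step with `varPow` and `θ`, so that `δ` computes when the
  -- outermost variable is peeled off.
  δ : ∀ {n} → Fin n → Fin n → Carrier
  δ zero    zero    = 1#
  δ zero    (suc j) = 0#
  δ (suc i) zero    = 0#
  δ (suc i) (suc j) = δ i j

  sum-zero : ∀ {n} (f : Fin n → Carrier) → (∀ i → f i ≈ 0#) → sum f ≈ 0#
  sum-zero {n} f f≈0 = trans (sum-cong-≋ f≈0) (sum-replicate-zero n)

  sum-δ : ∀ {n} (i : Fin n) (f : Fin n → Carrier) → sum (λ j → δ i j * f j) ≈ f i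
  sum-δ zero f = begin
    1# * f zero + sum (λ j → 0# * f (suc j))  ≈⟨ +-cong (*-identityˡ _) (sum-zero (λ j → 0# * f (suc j)) (λ j → zeroˡ _)) ⟩
    f zero + 0#                               ≈⟨ +-identityʳ _ ⟩
    f zero                                    ∎
  sum-δ (suc i) f = begin
    0# * f zero + sum (λ j → δ i j * f (suc j))  ≈⟨ +-cong (zeroˡ _) (sum-δ i (f ∘ suc)) ⟩
    0# + f (suc i)                               ≈⟨ +-identityˡ _ ⟩
    f (suc i)                                    ∎

  δ-≡ : ∀ {m} (i : Fin m) → δ i i ≡ 1#
  δ-≡ zero    = ≡.refl
  δ-≡ (suc i) = δ-≡ i

  δ-≢ : ∀ {m} (i j : Fin m) → ¬ (i ≡ j) → δ i j ≡ 0#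
  δ-≢ zero    zero    i≢j = contradiction ≡.refl i≢j
  δ-≢ zero    (suc j) i≢j = ≡.refl
  δ-≢ (suc i) zero    i≢j = ≡.refl
  δ-≢ (suc i) (suc j) i≢j = δ-≢ i j (i≢j ∘ ≡.cong suc)

  neg-isAdditive : IsAdditive R R (-_)
  neg-isAdditive = record { cong = -‿cong ; +-homo = λ x y → sym (⁻¹-∙-comm x y) }

  sum-sub : ∀ {n} (f g : Fin n → Carrier) → sum (λ i → f i - g i) ≈ sum f - sum g
  sum-sub f g = trans (∑-distrib-+ f (λ i → - g i))
    (+-congˡ (sym (IsAdditive.sum-homo neg-isAdditive g)))

  sum-product : ∀ {n} (f g : Fin n → Carrier) → sum (λ i → sum (λ j → f i * g j)) ≈ sum f * sum g
  sum-product f g = begin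
    sum (λ i → sum (λ j → f i * g j))  ≈⟨ sum-cong-≋ (λ i → *-distribˡ-sum (f i) g) ⟨
    sum (λ i → f i * sum g)            ≈⟨ *-distribʳ-sum (sum g) f ⟨
    sum f * sum g                      ∎

module Derivations (R : CommutativeRing 0ℓ 0ℓ) where
  open CommutativeRing R hiding (zero)
  open import Algebra.Properties.Ring ring
  open import Algebra.Properties.Semiring.Sum semiring
  open import Algebra.Definitions.RawSemiring (RawRing.rawSemiring rawRing) using (product; _^_)
  open import Relation.Binary.Reasoning.Setoid setoid
  open import Algebra.Properties.Semiring.Mult.TCOptimised semiring using (1+×)
  open IntegerSolver R

  record IsDerivation (D : Carrier → Carrier) : Set where
    field
      isAdditive : IsAdditive R R D
      leibniz    : ∀ x y → D (x * y) ≈ D x * y + x * D y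
    open IsAdditive isAdditive public

    D1≈0 : D 1# ≈ 0#
    D1≈0 = x+x≈x⇒x≈0 (D 1#) (begin
      D 1# + D 1#            ≈⟨ +-cong (*-identityʳ _) (*-identityˡ _) ⟨
      D 1# * 1# + 1# * D 1#  ≈⟨ leibniz 1# 1# ⟨
      D (1# * 1#)            ≈⟨ cong (*-identityˡ 1#) ⟩
      D 1#                   ∎)

  -- LogDerivative D f l reads D f / f = l without dividing by f.
  LogDerivative : (D : Carrier → Carrier) (f l : Carrier) → Set
  LogDerivative D f l = D f ≈ l * f

  module _ {D : Carrier → Carrier} (isDerivation : IsDerivation D) where
    open IsDerivation isDerivation

    log-cong : ∀ {f g l m} → f ≈ g → l ≈ m → LogDerivative D f l → LogDerivative D g m
    log-cong f≈g l≈m p = trans (cong (sym f≈g)) (trans p (*-cong l≈m f≈g))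

    log-1 : LogDerivative D 1# 0#
    log-1 = trans D1≈0 (sym (zeroˡ 1#))

    log-* : ∀ {f g l m} → LogDerivative D f l → LogDerivative D g m → LogDerivative D (f * g) (l + m)
    log-* {f} {g} {l} {m} p q = begin
      D (f * g)                  ≈⟨ leibniz f g ⟩
      D f * g + f * D g          ≈⟨ +-cong (*-congʳ p) (*-congˡ q) ⟩
      l * f * g + f * (m * g)    ≈⟨ solve 4 (λ f g l m → l :* f :* g :+ f :* (m :* g) := (l :+ m) :* (f :* g)) refl f g l m ⟩
      (l + m) * (f * g)          ∎

    log-^ : ∀ {f l} → LogDerivative D f l → ∀ m → LogDerivative D (f ^ m) (⟦ + m ⟧ᶻ * l)
    log-^ {f} {l} p zero    = log-cong refl (sym (zeroˡ l)) log-1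
    log-^ {f} {l} p (suc m) = log-cong refl
      (begin
        l + ⟦ + m ⟧ᶻ * l          ≈⟨ +-congʳ (*-identityˡ l) ⟨
        1# * l + ⟦ + m ⟧ᶻ * l     ≈⟨ distribʳ l _ _ ⟨
        (1# + ⟦ + m ⟧ᶻ) * l       ≈⟨ *-congʳ (1+× m 1#) ⟨
        ⟦ + suc m ⟧ᶻ * l          ∎)
      (log-* p (log-^ p m))

    log-product : ∀ {n} {f l : Fin n → Carrier} → (∀ i → LogDerivative D (f i) (l i)) →
                  LogDerivative D (product f) (sum l)
    log-product {zero}  p = log-1
    log-product {suc n} p = log-* (p zero) (log-product (p ∘ suc))

    -- Since D (f g) = D 1 = 0, the product rule gives f · D g = - D f · g; multiplying by g then
    -- removes f.
    log-inverse : ∀ {f g} → f * g ≈ 1# → LogDerivative D g (- (D f * g))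
    log-inverse {f} {g} fg≈1 = begin
      D g                                ≈⟨ solve 4 (λ f g Df Dg → Dg := (Df :* g :+ f :* Dg) :* g :- Df :* g :* g :+ (con 1ℤ :- f :* g) :* Dg)
                                              refl f g (D f) (D g) ⟩
      (D f * g + f * D g) * g - D f * g * g + (1# - f * g) * D g
                                         ≈⟨ +-cong (+-congʳ (*-congʳ (trans (sym (leibniz f g)) (trans (cong fg≈1) D1≈0))))
                                                   (*-congʳ (+-congˡ (-‿cong fg≈1))) ⟩
      0# * g - D f * g * g + (1# - 1#) * D g
                                         ≈⟨ solve 3 (λ g Df Dg → con 0ℤ :* g :- Df :* g :* g :+ (con 1ℤ :- con 1ℤ) :* Dg := (:- (Df :* g)) :* g)
                                              refl g (D f) (D g) ⟩
      - (D f * g) * g                    ∎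

    -- For g = 1 / (1 - p) one has D g / g = D p / (1 - p). It is applied to monomials p, where l is
    -- an integer constant, so both kinds of geometric series get a constant multiple of p / (1 -
    -- p).
    log-geometric : ∀ {p g l} → (1# - p) * g ≈ 1# →
                    LogDerivative D p l → LogDerivative D g (l * (p * g))
    log-geometric {p} {g} {l} inverse log-p =
      log-cong refl (begin
        - (D (1# - p) * g)       ≈⟨ -‿cong (*-congʳ (+-homo 1# (- p))) ⟩
        - ((D 1# + D (- p)) * g) ≈⟨ -‿cong (*-congʳ (+-cong D1≈0 (trans (-‿homo p) (-‿cong log-p)))) ⟩
        - ((0# - l * p) * g)     ≈⟨ solve 3 (λ l p g → :- ((con 0ℤ :- l :* p) :* g) := l :* (p :* g)) refl l p g ⟩
        l * (p * g)              ∎)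
        (log-inverse inverse)

-- Laurent series

data Position (e d : ℤ) : Set where
  above : ∀ m → e ≡ d ℤ.+ + m → Position e d
  below : ∀ m → e ≡ d ℤ.+ -[1+ m ] → Position e d

d+[e-d]≡e : ∀ e d → e ≡ d ℤ.+ (e ℤ.- d)
d+[e-d]≡e = solve 2 (λ e d → e := d :+ (e :- d)) ≡.refl
  where open ℤSolver.+-*-Solver

[d+k]-d≡k : ∀ d k → d ℤ.+ k ℤ.- d ≡ k
[d+k]-d≡k = solve 2 (λ d k → d :+ k :- d := k) ≡.refl
  where open ℤSolver.+-*-Solver

position : ∀ e d → Position e d
position e d with e ℤ.- d in eq
... | + m      = above m (≡.trans (d+[e-d]≡e e d) (≡.cong (ℤ._+_ d) eq))
... | -[1+ m ] = below m (≡.trans (d+[e-d]≡e e d) (≡.cong (ℤ._+_ d) eq))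

module LaurentRing (R : CommutativeRing 0ℓ 0ℓ) where
  open CommutativeRing R hiding (zero)
  open import Algebra.Properties.AbelianGroup +-abelianGroup
  open import Algebra.Properties.Semiring.Sum semiring
  open FiniteSums R using (sum-zero)
  open import Relation.Binary.Reasoning.Setoid setoid
  module 𝕃 = RawRing (laurentRing rawRing)

  [_]_ : ℤ → Laurent Carrier → Carrier
  [_]_ = coeff rawRing

  infix 9 _‼_
  -- The extension by zero that is hidden inside `coeff`, under a name of its own so that lemmas can
  -- speak of it.
  _‼_ : (ℕ → Carrier) → ℤ → Carrier
  f ‼ (+ m)    = f m
  f ‼ -[1+ _ ] = 0#

  coeff≡‼ : ∀ e s → [ e ] s ≡ coeffs s ‼ (e ℤ.- ord s)
  coeff≡‼ e s with e ℤ.- ord s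
  ... | + m      = ≡.refl
  ... | -[1+ m ] = ≡.refl

  coeff-shift : ∀ {k d f} e → e ℤ.- d ≡ k → [ e ] ⟨ d , f ⟩ ≡ f ‼ k
  coeff-shift {d = d} {f} e ≡.refl = coeff≡‼ e ⟨ d , f ⟩

  coeff-above : ∀ d f m → [ d ℤ.+ + m ] ⟨ d , f ⟩ ≡ f m
  coeff-above d f m = coeff-shift (d ℤ.+ + m) ([d+k]-d≡k d (+ m))

  coeff-below : ∀ d f m → [ d ℤ.+ -[1+ m ] ] ⟨ d , f ⟩ ≡ 0#
  coeff-below d f m = coeff-shift (d ℤ.+ -[1+ m ]) ([d+k]-d≡k d -[1+ m ])

  coeff-< : ∀ e s → e ℤ.< ord s → [ e ] s ≡ 0#
  coeff-< e s e<d with position e (ord s)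
  ... | above m ≡.refl = contradiction e<d (ℤₚ.≤⇒≯ (ℤₚ.i≤i+j (ord s) (+ m)))
  ... | below m ≡.refl = coeff-below (ord s) (coeffs s) m

  coeff-+ : ∀ e s u → [ e ] (s 𝕃.+ u) ≈ [ e ] s + [ e ] u
  coeff-+ e s u with position e (ord s ℤ.⊓ ord u)
  ... | above m ≡.refl = reflexive (coeff-above (ord s ℤ.⊓ ord u) (coeffs (s 𝕃.+ u)) m)
  ... | below m ≡.refl = begin
    [ e′ ] (s 𝕃.+ u)      ≡⟨ coeff-below d (coeffs (s 𝕃.+ u)) m ⟩
    0#                    ≈⟨ +-identityˡ 0# ⟨
    0# + 0#               ≡⟨ ≡.cong₂ _+_ (coeff-< e′ s (ℤₚ.<-≤-trans e′<d (ℤₚ.i⊓j≤i (ord s) (ord u))))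
                                         (coeff-< e′ u (ℤₚ.<-≤-trans e′<d (ℤₚ.i⊓j≤j (ord s) (ord u)))) ⟨
    [ e′ ] s + [ e′ ] u   ∎
    where
    d = ord s ℤ.⊓ ord u
    e′ = d ℤ.+ -[1+ m ]
    e′<d : e′ ℤ.< d
    e′<d = ≡.subst (e′ ℤ.<_) (ℤₚ.+-identityʳ d) (ℤₚ.+-monoʳ-< d ℤ.-<+)

  ‼-cong : ∀ {f g : ℕ → Carrier} → (∀ m → f m ≈ g m) → ∀ k → f ‼ k ≈ g ‼ k
  ‼-cong f≈g (+ m)    = f≈g m
  ‼-cong f≈g -[1+ m ] = refl

  ‼-neg : ∀ f k → ((-_) ∘ f) ‼ k ≈ - (f ‼ k)
  ‼-neg f (+ m)    = refl
  ‼-neg f -[1+ m ] = sym ε⁻¹≈ε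

  coeff-neg : ∀ e s → [ e ] (𝕃.- s) ≈ - [ e ] s
  coeff-neg e s = begin
    [ e ] (𝕃.- s)                         ≡⟨ coeff≡‼ e (𝕃.- s) ⟩
    ((-_) ∘ coeffs s) ‼ (e ℤ.- ord s)     ≈⟨ ‼-neg (coeffs s) (e ℤ.- ord s) ⟩
    - (coeffs s ‼ (e ℤ.- ord s))          ≡⟨ ≡.cong (-_) (coeff≡‼ e s) ⟨
    - [ e ] s                             ∎

  single : Carrier → ℕ → Carrier
  single = constantTail rawRing

  single-0 : ∀ k → single 0# ‼ k ≈ 0#
  single-0 (+ zero)  = refl
  single-0 (+ suc _) = refl
  single-0 -[1+ _ ]  = refl

  coeff-const : ∀ e r → [ e ] const rawRing r ≡ single r ‼ e
  coeff-const e r = coeff-shift {d = 0ℤ} e (ℤₚ.+-identityʳ e)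

  coeff-0 : ∀ e → [ e ] 𝕃.0# ≈ 0#
  coeff-0 e = trans (reflexive (coeff-const e 0#)) (single-0 e)

  -- conv f g (suc m) unfolds to f 0 * g (suc m) + conv (f ∘ suc) g m.
  conv : (f g : ℕ → Carrier) → ℕ → Carrier
  conv f g m = sum {suc m} (λ i → f (toℕ i) * g (m ℕ.∸ toℕ i))

  -- `conv` peels the first coefficient of f by definition. Peeling that of g as well makes
  -- commutativity a plain induction.
  conv-sucʳ : ∀ f g m → conv f g (suc m) ≈ f (suc m) * g 0 + conv f (g ∘ suc) m
  conv-sucʳ f g zero    = begin
    f 0 * g 1 + (f 1 * g 0 + 0#)  ≈⟨ +-congˡ (+-identityʳ _) ⟩
    f 0 * g 1 + f 1 * g 0         ≈⟨ +-comm _ _ ⟩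
    f 1 * g 0 + f 0 * g 1         ≈⟨ +-congˡ (+-identityʳ _) ⟨
    f 1 * g 0 + (f 0 * g 1 + 0#)  ∎
  conv-sucʳ f g (suc m) = begin
    f 0 * g (2 ℕ.+ m) + conv (f ∘ suc) g (suc m)
      ≈⟨ +-congˡ (conv-sucʳ (f ∘ suc) g m) ⟩
    f 0 * g (2 ℕ.+ m) + (f (2 ℕ.+ m) * g 0 + conv (f ∘ suc) (g ∘ suc) m)
      ≈⟨ x∙yz≈y∙xz _ _ _ ⟩
    f (2 ℕ.+ m) * g 0 + (f 0 * g (2 ℕ.+ m) + conv (f ∘ suc) (g ∘ suc) m)
      ∎
    where open import Algebra.Properties.CommutativeSemigroup +-commutativeSemigroup

  conv-comm : ∀ f g m → conv f g m ≈ conv g f m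
  conv-comm f g zero    = +-congʳ (*-comm (f 0) (g 0))
  conv-comm f g (suc m) = begin
    f 0 * g (suc m) + conv (f ∘ suc) g m  ≈⟨ +-cong (*-comm _ _) (conv-comm (f ∘ suc) g m) ⟩
    g (suc m) * f 0 + conv g (f ∘ suc) m  ≈⟨ conv-sucʳ g f m ⟨
    conv g f (suc m)                      ∎

  -- The combination on the left is exactly what `conv f g` unfolds to at a successor, as needed in
  -- the induction for associativity.
  conv-linearˡ : ∀ a f g h m → conv (λ k → a * f k + g k) h m ≈ a * conv f h m + conv g h m
  conv-linearˡ a f g h m = begin
    conv (λ k → a * f k + g k) h m
      ≈⟨ sum-cong-≋ {suc m} (λ i → trans (distribʳ (h (m ℕ.∸ toℕ i)) (a * f (toℕ i)) (g (toℕ i)))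
                                         (+-congʳ (*-assoc a (f (toℕ i)) (h (m ℕ.∸ toℕ i))))) ⟩
    sum {suc m} (λ i → a * fh i + gh i)
      ≈⟨ ∑-distrib-+ {suc m} (λ i → a * fh i) gh ⟩
    sum {suc m} (λ i → a * fh i) + conv g h m
      ≈⟨ +-congʳ (*-distribˡ-sum {suc m} a fh) ⟨
    a * conv f h m + conv g h m  ∎
    where
    fh gh : Fin (suc m) → Carrier
    fh i = f (toℕ i) * h (m ℕ.∸ toℕ i)
    gh i = g (toℕ i) * h (m ℕ.∸ toℕ i)

  conv-assoc : ∀ f g h m → conv (conv f g) h m ≈ conv f (conv g h) m
  conv-assoc f g h zero = +-congʳ (begin
    (f 0 * g 0 + 0#) * h 0    ≈⟨ *-congʳ (+-identityʳ _) ⟩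
    f 0 * g 0 * h 0           ≈⟨ *-assoc _ _ _ ⟩
    f 0 * (g 0 * h 0)         ≈⟨ *-congˡ (+-identityʳ _) ⟨
    f 0 * (g 0 * h 0 + 0#)    ∎)
  conv-assoc f g h (suc m) = begin
    (f 0 * g 0 + 0#) * h (suc m) + conv (λ k → f 0 * g (suc k) + conv (f ∘ suc) g k) h m
      ≈⟨ +-cong (*-congʳ (+-identityʳ _)) (conv-linearˡ (f 0) (g ∘ suc) (conv (f ∘ suc) g) h m) ⟩
    f 0 * g 0 * h (suc m) + (f 0 * conv (g ∘ suc) h m + conv (conv (f ∘ suc) g) h m)
      ≈⟨ +-cong (*-assoc _ _ _) (+-congˡ (conv-assoc (f ∘ suc) g h m)) ⟩
    f 0 * (g 0 * h (suc m)) + (f 0 * conv (g ∘ suc) h m + conv (f ∘ suc) (conv g h) m)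
      ≈⟨ +-assoc _ _ _ ⟨
    f 0 * (g 0 * h (suc m)) + f 0 * conv (g ∘ suc) h m + conv (f ∘ suc) (conv g h) m
      ≈⟨ +-congʳ (distribˡ _ _ _) ⟨
    f 0 * conv g h (suc m) + conv (f ∘ suc) (conv g h) m  ∎

  -- The sum over i may be cut off at any N > k, uniformly in the two series:
  -- this makes the product visibly bilinear.
  conv-‼ : ∀ f g k N → ℤ.∣ k ∣ ℕ.< N →
           conv f g ‼ k ≈ sum {N} (λ i → f (toℕ i) * g ‼ (k ℤ.- + toℕ i))
  conv-‼ f g -[1+ m ] (suc N) _ = sym (sum-zero {suc N}
    (λ i → f (toℕ i) * g ‼ (-[1+ m ] ℤ.- + toℕ i)) λ where
    zero    → zeroʳ (f 0)
    (suc i) → zeroʳ (f (suc (toℕ i))))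
  conv-‼ f g (+ zero) (suc N) _ =
    +-congˡ (sym (sum-zero {N} _ (λ i → zeroʳ _)))
  conv-‼ f g (+ suc m) (suc N) (s≤s m<N) = +-cong
    (*-congˡ (reflexive (≡.cong (λ k → g (suc k)) (≡.sym (ℕₚ.+-identityʳ m)))))
    (trans (conv-‼ (f ∘ suc) g (+ m) N m<N)
      (sum-cong-≋ {N} (λ i → *-congˡ (reflexive (≡.cong (g ‼_) (step m (toℕ i)))))))
    where
    step : ∀ m i → + m ℤ.- + i ≡ + suc m ℤ.- + suc i
    step m i = ≡.trans (ℤₚ.m-n≡m⊖n m i) (≡.sym (ℤₚ.[1+m]⊖[1+n]≡m⊖n m i))

  -- Any cut-off beyond this bound leaves the product coefficient at e unchanged; a sum of several
  -- excesses hence gives a cut-off that serves several products at once.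
  excess : ℤ → (s u : Laurent Carrier) → ℕ
  excess e s u = ℤ.∣ e ℤ.- ord (s 𝕃.* u) ∣

  coeff-* : ∀ e s u N → excess e s u ℕ.< N →
            [ e ] (s 𝕃.* u) ≈ sum {N} (λ i → coeffs s (toℕ i) * [ e ℤ.- (ord s ℤ.+ + toℕ i) ] u)
  coeff-* e s u N e<N = begin
    [ e ] (s 𝕃.* u)
      ≡⟨ coeff≡‼ e (s 𝕃.* u) ⟩
    conv (coeffs s) (coeffs u) ‼ k
      ≈⟨ conv-‼ (coeffs s) (coeffs u) k N e<N ⟩
    sum {N} (λ i → coeffs s (toℕ i) * coeffs u ‼ (k ℤ.- + toℕ i))
      ≈⟨ sum-cong-≋ {N} (λ i → *-congˡ (reflexive (coeff-shift (e ℤ.- (ord s ℤ.+ + toℕ i))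
           (arith e (ord s) (ord u) (+ toℕ i))))) ⟨
    sum {N} (λ i → coeffs s (toℕ i) * [ e ℤ.- (ord s ℤ.+ + toℕ i) ] u)
      ∎
    where
    k = e ℤ.- (ord s ℤ.+ ord u)
    arith : ∀ e p q i → e ℤ.- (p ℤ.+ i) ℤ.- q ≡ e ℤ.- (p ℤ.+ q) ℤ.- i
    arith = solve 4 (λ e p q i → e :- (p :+ i) :- q := e :- (p :+ q) :- i) ≡.refl
      where open ℤSolver.+-*-Solver

  *-comm′ : ∀ s u → s 𝕃.* u 𝕃.≈ u 𝕃.* s
  *-comm′ s u e = begin
    [ e ] (s 𝕃.* u)
      ≡⟨ coeff≡‼ e (s 𝕃.* u) ⟩
    conv (coeffs s) (coeffs u) ‼ (e ℤ.- (ord s ℤ.+ ord u))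
      ≈⟨ ‼-cong (conv-comm (coeffs s) (coeffs u)) (e ℤ.- (ord s ℤ.+ ord u)) ⟩
    conv (coeffs u) (coeffs s) ‼ (e ℤ.- (ord s ℤ.+ ord u))
      ≡⟨ ≡.cong (λ d → conv (coeffs u) (coeffs s) ‼ (e ℤ.- d)) (ℤₚ.+-comm (ord s) (ord u)) ⟩
    conv (coeffs u) (coeffs s) ‼ (e ℤ.- (ord u ℤ.+ ord s))
      ≡⟨ coeff≡‼ e (u 𝕃.* s) ⟨
    [ e ] (u 𝕃.* s)  ∎

  *-assoc′ : ∀ s u v → (s 𝕃.* u) 𝕃.* v 𝕃.≈ s 𝕃.* (u 𝕃.* v)
  *-assoc′ s u v e = begin
    [ e ] ((s 𝕃.* u) 𝕃.* v)
      ≡⟨ coeff-shift e ≡.refl ⟩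
    conv (conv (coeffs s) (coeffs u)) (coeffs v) ‼ (e ℤ.- (ord s ℤ.+ ord u ℤ.+ ord v))
      ≈⟨ ‼-cong (conv-assoc (coeffs s) (coeffs u) (coeffs v)) (e ℤ.- (ord s ℤ.+ ord u ℤ.+ ord v)) ⟩
    conv (coeffs s) (conv (coeffs u) (coeffs v)) ‼ (e ℤ.- (ord s ℤ.+ ord u ℤ.+ ord v))
      ≡⟨ coeff-shift e (≡.cong (λ d → e ℤ.- d) (≡.sym (ℤₚ.+-assoc (ord s) (ord u) (ord v)))) ⟨
    [ e ] (s 𝕃.* (u 𝕃.* v))  ∎

  -- Equal series may start at different orders, so their coefficient sequences cannot be compared
  -- index by index. In the cut-off form of the product the second factor enters only through its
  -- coefficients at given exponents, and those agree.
  *-congˡ′ : ∀ s {u v} → u 𝕃.≈ v → s 𝕃.* u 𝕃.≈ s 𝕃.* v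
  *-congˡ′ s {u} {v} u≈v e = begin
    [ e ] (s 𝕃.* u)
      ≈⟨ coeff-* e s u N (s≤s (ℕₚ.m≤m+n (excess e s u) (excess e s v))) ⟩
    sum {N} (λ i → coeffs s (toℕ i) * [ e ℤ.- (ord s ℤ.+ + toℕ i) ] u)
      ≈⟨ sum-cong-≋ {N} (λ i → *-congˡ {coeffs s (toℕ i)} (u≈v (e ℤ.- (ord s ℤ.+ + toℕ i)))) ⟩
    sum {N} (λ i → coeffs s (toℕ i) * [ e ℤ.- (ord s ℤ.+ + toℕ i) ] v)
      ≈⟨ coeff-* e s v N (s≤s (ℕₚ.m≤n+m (excess e s v) (excess e s u))) ⟨
    [ e ] (s 𝕃.* v)  ∎
    where N = suc (excess e s u ℕ.+ excess e s v)

  *-cong′ : ∀ {s s′ u u′} → s 𝕃.≈ s′ → u 𝕃.≈ u′ → s 𝕃.* u 𝕃.≈ s′ 𝕃.* u′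
  *-cong′ {s} {s′} {u} {u′} s≈s′ u≈u′ e =
    trans (*-congˡ′ s {u} {u′} u≈u′ e)
      (trans (*-comm′ s u′ e) (trans (*-congˡ′ u′ {s} {s′} s≈s′ e) (*-comm′ u′ s′ e)))

  *-distribˡ′ : ∀ s u v → s 𝕃.* (u 𝕃.+ v) 𝕃.≈ s 𝕃.* u 𝕃.+ s 𝕃.* v
  *-distribˡ′ s u v e = begin
    [ e ] (s 𝕃.* (u 𝕃.+ v))
      ≈⟨ coeff-* e s (u 𝕃.+ v) N (s≤s (ℕₚ.m≤m+n (excess e s (u 𝕃.+ v)) _)) ⟩
    sum {N} (λ i → coeffs s (toℕ i) * [ deg i ] (u 𝕃.+ v))
      ≈⟨ sum-cong-≋ {N} (λ i → trans (*-congˡ {coeffs s (toℕ i)} (coeff-+ (deg i) u v))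
                                    (distribˡ (coeffs s (toℕ i)) ([ deg i ] u) ([ deg i ] v))) ⟩
    sum {N} (λ i → coeffs s (toℕ i) * [ deg i ] u + coeffs s (toℕ i) * [ deg i ] v)
      ≈⟨ ∑-distrib-+ {N} (λ i → coeffs s (toℕ i) * [ deg i ] u) (λ i → coeffs s (toℕ i) * [ deg i ] v) ⟩
    sum {N} (λ i → coeffs s (toℕ i) * [ deg i ] u) + sum {N} (λ i → coeffs s (toℕ i) * [ deg i ] v)
      ≈⟨ +-cong (coeff-* e s u N (s≤s (ℕₚ.≤-trans (ℕₚ.m≤m+n (excess e s u) (excess e s v)) (ℕₚ.m≤n+m _ (excess e s (u 𝕃.+ v))))))
                (coeff-* e s v N (s≤s (ℕₚ.≤-trans (ℕₚ.m≤n+m (excess e s v) (excess e s u)) (ℕₚ.m≤n+m _ (excess e s (u 𝕃.+ v)))))) ⟨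
    [ e ] (s 𝕃.* u) + [ e ] (s 𝕃.* v)
      ≈⟨ coeff-+ e (s 𝕃.* u) (s 𝕃.* v) ⟨
    [ e ] (s 𝕃.* u 𝕃.+ s 𝕃.* v)  ∎
    where
    N = suc (excess e s (u 𝕃.+ v) ℕ.+ (excess e s u ℕ.+ excess e s v))
    deg : Fin N → ℤ
    deg i = e ℤ.- (ord s ℤ.+ + toℕ i)

  coeff-term-* : ∀ e d r s → [ e ] (⟨ d , single r ⟩ 𝕃.* s) ≈ r * [ e ℤ.- d ] s
  coeff-term-* e d r s = begin
    [ e ] (⟨ d , single r ⟩ 𝕃.* s)
      ≈⟨ coeff-* e ⟨ d , single r ⟩ s (suc N) ℕₚ.≤-refl ⟩
    r * [ e ℤ.- (d ℤ.+ 0ℤ) ] s + sum {N} (λ i → 0# * [ e ℤ.- (d ℤ.+ + suc (toℕ i)) ] s)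
      ≈⟨ +-cong (*-congˡ (reflexive (≡.cong (λ k → [ e ℤ.- k ] s) (ℤₚ.+-identityʳ d))))
                (sum-zero {N} _ (λ i → zeroˡ _)) ⟩
    r * [ e ℤ.- d ] s + 0#
      ≈⟨ +-identityʳ _ ⟩
    r * [ e ℤ.- d ] s  ∎
    where N = excess e ⟨ d , single r ⟩ s

  coeff-const-* : ∀ e r s → [ e ] (const rawRing r 𝕃.* s) ≈ r * [ e ] s
  coeff-const-* e r s = trans (coeff-term-* e 0ℤ r s)
    (*-congˡ (reflexive (≡.cong (λ k → [ k ] s) (ℤₚ.+-identityʳ e))))

  *-identityˡ′ : ∀ s → 𝕃.1# 𝕃.* s 𝕃.≈ s
  *-identityˡ′ s e = trans (coeff-const-* e 1# s) (*-identityˡ _)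

  opaque
    isCommutativeRing′ : IsCommutativeRing 𝕃._≈_ 𝕃._+_ 𝕃._*_ 𝕃.-_ 𝕃.0# 𝕃.1#
    isCommutativeRing′ = record
      { isRing = record
        { +-isAbelianGroup = record
          { isGroup = record
            { isMonoid = record
              { isSemigroup = record
                { isMagma = record
                  { isEquivalence = record
                    { refl = λ _ → refl ; sym = λ p e → sym (p e) ; trans = λ p q e → trans (p e) (q e) }
                  ; ∙-cong = λ {s} {s′} {u} {u′} p q e → trans (coeff-+ e s u)
                               (trans (+-cong (p e) (q e)) (sym (coeff-+ e s′ u′)))
                  }
                ; assoc = λ s u v e → begin
                    [ e ] (s 𝕃.+ u 𝕃.+ v)          ≈⟨ coeff-+ e (s 𝕃.+ u) v ⟩
                    [ e ] (s 𝕃.+ u) + [ e ] v      ≈⟨ +-congʳ (coeff-+ e s u) ⟩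
                    [ e ] s + [ e ] u + [ e ] v    ≈⟨ +-assoc _ _ _ ⟩
                    [ e ] s + ([ e ] u + [ e ] v)  ≈⟨ +-congˡ (coeff-+ e u v) ⟨
                    [ e ] s + [ e ] (u 𝕃.+ v)      ≈⟨ coeff-+ e s (u 𝕃.+ v) ⟨
                    [ e ] (s 𝕃.+ (u 𝕃.+ v))        ∎
                }
              ; identity =
                  (λ s e → trans (coeff-+ e 𝕃.0# s) (trans (+-congʳ (coeff-0 e)) (+-identityˡ _)))
                , (λ s e → trans (coeff-+ e s 𝕃.0#) (trans (+-congˡ (coeff-0 e)) (+-identityʳ _)))
              }
            ; inverse =
                (λ s e → trans (coeff-+ e (𝕃.- s) s)
                  (trans (+-congʳ (coeff-neg e s)) (trans (-‿inverseˡ _) (sym (coeff-0 e)))))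
              , (λ s e → trans (coeff-+ e s (𝕃.- s))
                  (trans (+-congˡ (coeff-neg e s)) (trans (-‿inverseʳ _) (sym (coeff-0 e)))))
            ; ⁻¹-cong = λ {s} {u} p e → trans (coeff-neg e s) (trans (-‿cong (p e)) (sym (coeff-neg e u)))
            }
          ; comm = λ s u e → trans (coeff-+ e s u) (trans (+-comm _ _) (sym (coeff-+ e u s)))
          }
        ; *-cong = λ {s} {s′} {u} {u′} → *-cong′ {s} {s′} {u} {u′}
        ; *-assoc = *-assoc′
        ; *-identity = *-identityˡ′ , (λ s e → trans (*-comm′ s 𝕃.1# e) (*-identityˡ′ s e))
        ; distrib = *-distribˡ′ , (λ s u v e → begin
            [ e ] ((u 𝕃.+ v) 𝕃.* s)              ≈⟨ *-comm′ (u 𝕃.+ v) s e ⟩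
            [ e ] (s 𝕃.* (u 𝕃.+ v))              ≈⟨ *-distribˡ′ s u v e ⟩
            [ e ] (s 𝕃.* u 𝕃.+ s 𝕃.* v)          ≈⟨ coeff-+ e (s 𝕃.* u) (s 𝕃.* v) ⟩
            [ e ] (s 𝕃.* u) + [ e ] (s 𝕃.* v)    ≈⟨ +-cong (*-comm′ s u e) (*-comm′ s v e) ⟩
            [ e ] (u 𝕃.* s) + [ e ] (v 𝕃.* s)    ≈⟨ coeff-+ e (u 𝕃.* s) (v 𝕃.* s) ⟨
            [ e ] (u 𝕃.* s 𝕃.+ v 𝕃.* s)          ∎)
        }
      ; *-comm = *-comm′
      }

-- Derivations of a Laurent series ring

module LaurentDerivations (R : CommutativeRing 0ℓ 0ℓ) where
  open CommutativeRing R hiding (zero)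
  open LaurentRing R
  open import Algebra.Properties.Ring ring
  open import Algebra.Properties.Semiring.Sum semiring
  open import Relation.Binary.Reasoning.Setoid setoid
  open IntegerSolver R
  open Derivations R using (IsDerivation; module IsDerivation)

  laurentCommutativeRing : CommutativeRing 0ℓ 0ℓ
  laurentCommutativeRing = record { isCommutativeRing = isCommutativeRing′ }

  private
    module Z = IntegerSolver laurentCommutativeRing
    module D𝕃 = Derivations laurentCommutativeRing
    module C𝕃 = CommutativeRing laurentCommutativeRing

  coeff-isAdditive : ∀ e → IsAdditive laurentCommutativeRing R [ e ]_
  coeff-isAdditive e = record { cong = λ p → p e ; +-homo = coeff-+ e }

  -- Letting the map on coefficients depend on the exponent covers two operators at once: x ∂/∂x,
  -- which scales the coefficient at e by e, and a derivation of the coefficient ring applied to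
  -- every coefficient.
  gradedMap : (ℤ → Carrier → Carrier) → Laurent Carrier → Laurent Carrier
  gradedMap Φ s = ⟨ ord s , (λ m → Φ (ord s ℤ.+ + m) (coeffs s m)) ⟩

  module _ (Φ : ℤ → Carrier → Carrier) (Φ-isAdditive : ∀ e → IsAdditive R R (Φ e)) where
    private module Φ e = IsAdditive (Φ-isAdditive e)

    coeff-gradedMap : ∀ e s → [ e ] gradedMap Φ s ≈ Φ e ([ e ] s)
    coeff-gradedMap e s with position e (ord s)
    ... | above m ≡.refl = trans (reflexive (coeff-above (ord s) _ m))
      (Φ.cong _ (reflexive (≡.sym (coeff-above (ord s) (coeffs s) m))))
    ... | below m ≡.refl = trans (reflexive (coeff-below (ord s) _ m))
      (trans (sym (Φ.0-homo _)) (Φ.cong _ (reflexive (≡.sym (coeff-below (ord s) (coeffs s) m)))))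

    gradedMap-isDerivation :
      (∀ p q x y → Φ (p ℤ.+ q) (x * y) ≈ Φ p x * y + x * Φ q y) → D𝕃.IsDerivation (gradedMap Φ)
    gradedMap-isDerivation Φ-* = record
      { isAdditive = record
        { cong = λ {s} {u} p e → trans (coeff-gradedMap e s) (trans (Φ.cong e (p e)) (sym (coeff-gradedMap e u)))
        ; +-homo = λ s u e → begin
            [ e ] gradedMap Φ (s 𝕃.+ u)                    ≈⟨ coeff-gradedMap e (s 𝕃.+ u) ⟩
            Φ e ([ e ] (s 𝕃.+ u))                          ≈⟨ Φ.cong e (coeff-+ e s u) ⟩
            Φ e ([ e ] s + [ e ] u)                        ≈⟨ Φ.+-homo e _ _ ⟩
            Φ e ([ e ] s) + Φ e ([ e ] u)                  ≈⟨ +-cong (coeff-gradedMap e s) (coeff-gradedMap e u) ⟨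
            [ e ] gradedMap Φ s + [ e ] gradedMap Φ u      ≈⟨ coeff-+ e (gradedMap Φ s) (gradedMap Φ u) ⟨
            [ e ] (gradedMap Φ s 𝕃.+ gradedMap Φ u)        ∎
        }
      ; leibniz = leibniz
      }
      where
      leibniz : ∀ s u → gradedMap Φ (s 𝕃.* u) 𝕃.≈ gradedMap Φ s 𝕃.* u 𝕃.+ s 𝕃.* gradedMap Φ u
      leibniz s u e = begin
        [ e ] gradedMap Φ (s 𝕃.* u)
          ≈⟨ coeff-gradedMap e (s 𝕃.* u) ⟩
        Φ e ([ e ] (s 𝕃.* u))
          ≈⟨ Φ.cong e (coeff-* e s u N ℕₚ.≤-refl) ⟩
        Φ e (sum {N} (λ i → a i * [ deg i ] u))
          ≈⟨ Φ.sum-homo e {N} (λ i → a i * [ deg i ] u) ⟩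
        sum {N} (λ i → Φ e (a i * [ deg i ] u))
          ≈⟨ sum-cong-≋ {N} (λ i → begin
               Φ e (a i * [ deg i ] u)
                 ≡⟨ ≡.cong (λ k → Φ k (a i * [ deg i ] u)) (d+[e-d]≡e e (ord s ℤ.+ + toℕ i)) ⟩
               Φ (ord s ℤ.+ + toℕ i ℤ.+ deg i) (a i * [ deg i ] u)
                 ≈⟨ Φ-* _ _ _ _ ⟩
               b i * [ deg i ] u + a i * Φ (deg i) ([ deg i ] u)
                 ≈⟨ +-congˡ {b i * [ deg i ] u} (*-congˡ {a i} (coeff-gradedMap (deg i) u)) ⟨
               b i * [ deg i ] u + a i * [ deg i ] gradedMap Φ u  ∎) ⟩
        sum {N} (λ i → b i * [ deg i ] u + a i * [ deg i ] gradedMap Φ u)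
          ≈⟨ ∑-distrib-+ {N} (λ i → b i * [ deg i ] u) (λ i → a i * [ deg i ] gradedMap Φ u) ⟩
        sum {N} (λ i → b i * [ deg i ] u) + sum {N} (λ i → a i * [ deg i ] gradedMap Φ u)
          -- `gradedMap` keeps the order of a series, so the one cut-off N is right for all three
          -- products.
          ≈⟨ +-cong (coeff-* e (gradedMap Φ s) u N ℕₚ.≤-refl) (coeff-* e s (gradedMap Φ u) N ℕₚ.≤-refl) ⟨
        [ e ] (gradedMap Φ s 𝕃.* u) + [ e ] (s 𝕃.* gradedMap Φ u)
          ≈⟨ coeff-+ e (gradedMap Φ s 𝕃.* u) (s 𝕃.* gradedMap Φ u) ⟨
        [ e ] (gradedMap Φ s 𝕃.* u 𝕃.+ s 𝕃.* gradedMap Φ u)  ∎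
        where
        N = suc (excess e s u)
        deg : Fin N → ℤ
        deg i = e ℤ.- (ord s ℤ.+ + toℕ i)
        a b : Fin N → Carrier
        a i = coeffs s (toℕ i)
        b i = coeffs (gradedMap Φ s) (toℕ i)

  scale-isAdditive : ∀ c → IsAdditive R R (c *_)
  scale-isAdditive c = record { cong = *-congˡ ; +-homo = distribˡ c }

  -- x ∂/∂x
  euler : Laurent Carrier → Laurent Carrier
  euler = gradedMap (λ e → ⟦ e ⟧ᶻ *_)

  coeff-euler : ∀ e s → [ e ] euler s ≈ ⟦ e ⟧ᶻ * [ e ] s
  coeff-euler = coeff-gradedMap (λ e → ⟦ e ⟧ᶻ *_) (λ e → scale-isAdditive ⟦ e ⟧ᶻ)

  euler-isDerivation : D𝕃.IsDerivation euler
  euler-isDerivation = gradedMap-isDerivation _ (λ e → scale-isAdditive ⟦ e ⟧ᶻ) λ p q x y → begin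
    ⟦ p ℤ.+ q ⟧ᶻ * (x * y)              ≈⟨ *-congʳ (⟦+⟧ p q) ⟩
    (⟦ p ⟧ᶻ + ⟦ q ⟧ᶻ) * (x * y)         ≈⟨ solve 4 (λ p q x y → (p :+ q) :* (x :* y) := p :* x :* y :+ x :* (q :* y)) refl ⟦ p ⟧ᶻ ⟦ q ⟧ᶻ x y ⟩
    ⟦ p ⟧ᶻ * x * y + x * (⟦ q ⟧ᶻ * y)   ∎

  module Coefficientwise {D : Carrier → Carrier} (D-isDerivation : IsDerivation D) where
    private module D = IsDerivation D-isDerivation

    coeffwise : Laurent Carrier → Laurent Carrier
    coeffwise = gradedMap (λ _ → D)

    coeff-coeffwise : ∀ e s → [ e ] coeffwise s ≈ D ([ e ] s)
    coeff-coeffwise = coeff-gradedMap (λ _ → D) (λ _ → D.isAdditive)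

    coeffwise-isDerivation : D𝕃.IsDerivation coeffwise
    coeffwise-isDerivation = gradedMap-isDerivation _ (λ _ → D.isAdditive) (λ _ _ → D.leibniz)

  ι : Carrier → Laurent Carrier
  ι = const rawRing

  single-isAdditive : ∀ k → IsAdditive R R (λ r → single r ‼ k)
  single-isAdditive (+ zero)  = record { cong = λ p → p ; +-homo = λ _ _ → refl }
  single-isAdditive (+ suc m) = record { cong = λ p → refl ; +-homo = λ _ _ → sym (+-identityˡ 0#) }
  single-isAdditive -[1+ m ]  = record { cong = λ p → refl ; +-homo = λ _ _ → sym (+-identityˡ 0#) }

  ι-isAdditive : IsAdditive R laurentCommutativeRing ι
  ι-isAdditive = record
    { cong = λ {r} {s} p e → trans (reflexive (coeff-const e r))
        (trans (IsAdditive.cong (single-isAdditive e) p) (reflexive (≡.sym (coeff-const e s))))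
    ; +-homo = λ r s e → begin
        [ e ] ι (r + s)              ≡⟨ coeff-const e (r + s) ⟩
        single (r + s) ‼ e           ≈⟨ IsAdditive.+-homo (single-isAdditive e) r s ⟩
        single r ‼ e + single s ‼ e  ≡⟨ ≡.cong₂ _+_ (coeff-const e r) (coeff-const e s) ⟨
        [ e ] ι r + [ e ] ι s        ≈⟨ coeff-+ e (ι r) (ι s) ⟨
        [ e ] (ι r 𝕃.+ ι s)          ∎
    }

  single-* : ∀ k r s → single (r * s) ‼ k ≈ r * single s ‼ k
  single-* (+ zero)  r s = refl
  single-* (+ suc m) r s = sym (zeroʳ r)
  single-* -[1+ m ]  r s = sym (zeroʳ r)

  ι-* : ∀ r s → ι (r * s) 𝕃.≈ ι r 𝕃.* ι s
  ι-* r s e = begin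
    [ e ] ι (r * s)      ≡⟨ coeff-const e (r * s) ⟩
    single (r * s) ‼ e   ≈⟨ single-* e r s ⟩
    r * single s ‼ e     ≡⟨ ≡.cong (r *_) (coeff-const e s) ⟨
    r * [ e ] ι s        ≈⟨ coeff-const-* e r (ι s) ⟨
    [ e ] (ι r 𝕃.* ι s)  ∎

  coeff-monomial-* : ∀ e d s → [ e ] (monomial rawRing d 𝕃.* s) ≈ [ e ℤ.- d ] s
  coeff-monomial-* e d s = trans (coeff-term-* e d 1# s) (*-identityˡ _)

  monomial-+ : ∀ d d′ → monomial rawRing (d ℤ.+ d′) 𝕃.≈ monomial rawRing d 𝕃.* monomial rawRing d′
  monomial-+ d d′ e = sym (begin
    [ e ] (monomial rawRing d 𝕃.* monomial rawRing d′)  ≈⟨ coeff-monomial-* e d (monomial rawRing d′) ⟩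
    [ e ℤ.- d ] monomial rawRing d′                     ≡⟨ coeff-shift (e ℤ.- d) (arith e d d′) ⟩
    single 1# ‼ (e ℤ.- (d ℤ.+ d′))                      ≡⟨ coeff≡‼ e (monomial rawRing (d ℤ.+ d′)) ⟨
    [ e ] monomial rawRing (d ℤ.+ d′)                   ∎)
    where
    arith : ∀ e d d′ → e ℤ.- d ℤ.- d′ ≡ e ℤ.- (d ℤ.+ d′)
    arith = ℤSolver.+-*-Solver.solve 3 (λ e d d′ → e S.:- d S.:- d′ S.:= e S.:- (d S.:+ d′)) ≡.refl
      where module S = ℤSolver.+-*-Solver

  -- The powers of a are given through their recursion because they come in different guises: the
  -- constant sequence 1 for `geom`, the negative powers of x_j for `geomRatio`, and the powers of
  -- -y_i for the inverse of 1 + t y_i.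
  geometric : ∀ a (f : ℕ → Carrier) → f 0 ≈ 1# → (∀ m → f (suc m) ≈ a * f m) →
              (𝕃.1# 𝕃.+ 𝕃.- (monomial rawRing 1ℤ 𝕃.* ι a)) 𝕃.* ⟨ 0ℤ , f ⟩ 𝕃.≈ 𝕃.1#
  geometric a f f0≈1 f-suc e = begin
    [ e ] ((𝕃.1# 𝕃.+ 𝕃.- (x 𝕃.* ι a)) 𝕃.* F)
      ≈⟨ Z.solve 3 (λ x a F → (Z.con 1ℤ Z.:- x Z.:* a) Z.:* F Z.:= F Z.:- x Z.:* (a Z.:* F)) (λ _ → refl) x (ι a) F e ⟩
    [ e ] (F 𝕃.+ 𝕃.- (x 𝕃.* (ι a 𝕃.* F)))
      ≈⟨ coeff-+ e F _ ⟩
    [ e ] F + [ e ] (𝕃.- (x 𝕃.* (ι a 𝕃.* F)))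
      ≈⟨ +-congˡ (coeff-neg e _) ⟩
    [ e ] F - [ e ] (x 𝕃.* (ι a 𝕃.* F))
      ≈⟨ +-congˡ (-‿cong (trans (coeff-monomial-* e 1ℤ (ι a 𝕃.* F)) (coeff-const-* (e ℤ.- 1ℤ) a F))) ⟩
    [ e ] F - a * [ e ℤ.- 1ℤ ] F
      ≡⟨ ≡.cong₂ (λ p q → p - a * q) (coeff-shift {d = 0ℤ} e (ℤₚ.+-identityʳ e)) (coeff-shift {d = 0ℤ} (e ℤ.- 1ℤ) (ℤₚ.+-identityʳ (e ℤ.- 1ℤ))) ⟩
    f ‼ e - a * f ‼ (e ℤ.- 1ℤ)
      ≈⟨ go e ⟩
    single 1# ‼ e
      ≡⟨ coeff-const e 1# ⟨
    [ e ] 𝕃.1#  ∎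
    where
    x = monomial rawRing 1ℤ
    F = ⟨ 0ℤ , f ⟩
    go : ∀ e → f ‼ e - a * f ‼ (e ℤ.- 1ℤ) ≈ single 1# ‼ e
    go (+ zero)  = trans (+-cong f0≈1 (trans (-‿cong (zeroʳ a)) -0#≈0#)) (+-identityʳ 1#)
    go (+ suc m) = trans (+-congʳ (f-suc m)) (-‿inverseʳ _)
    go -[1+ m ]  = trans (+-identityˡ _) (trans (-‿cong (zeroʳ a)) -0#≈0#)

module MonomialsAndConstants (R : CommutativeRing 0ℓ 0ℓ) where
  open CommutativeRing R hiding (zero)
  open LaurentRing R
  open LaurentDerivations R
  open import Relation.Binary.Reasoning.Setoid setoid
  open IntegerSolver R
  open Derivations R using (IsDerivation; module IsDerivation)
  private
    module Z = IntegerSolver laurentCommutativeRing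
    module D𝕃 = Derivations laurentCommutativeRing
    module C𝕃 = CommutativeRing laurentCommutativeRing
    module Dι = IsAdditive ι-isAdditive

  -- The coefficient at e vanishes unless e = d, so the scalar e may be replaced by d everywhere.
  euler-monomial : ∀ d → D𝕃.LogDerivative euler (monomial rawRing d) Z.⟦ d ⟧ᶻ
  euler-monomial d e = begin
    [ e ] euler x             ≈⟨ coeff-euler e x ⟩
    ⟦ e ⟧ᶻ * [ e ] x          ≈⟨ concentrated (position e d) ⟩
    ⟦ d ⟧ᶻ * [ e ] x          ≈⟨ IsAdditive.⟦⟧-homo (coeff-isAdditive e) d x ⟨
    [ e ] (Z.⟦ d ⟧ᶻ 𝕃.* x)    ∎
    where
    x = monomial rawRing d
    vanishing : ∀ e → [ e ] x ≡ 0# → ⟦ e ⟧ᶻ * [ e ] x ≈ ⟦ d ⟧ᶻ * [ e ] x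
    vanishing e p = trans (*-congˡ (reflexive p)) (trans (zeroʳ _)
      (sym (trans (*-congˡ (reflexive p)) (zeroʳ _))))
    concentrated : ∀ {e} → Position e d → ⟦ e ⟧ᶻ * [ e ] x ≈ ⟦ d ⟧ᶻ * [ e ] x
    concentrated (above zero ≡.refl) =
      *-congʳ (reflexive (≡.cong ⟦_⟧ᶻ (ℤₚ.+-identityʳ d)))
    concentrated (above (suc m) ≡.refl) = vanishing (d ℤ.+ + suc m) (coeff-above d (single 1#) (suc m))
    concentrated (below m ≡.refl)       = vanishing (d ℤ.+ -[1+ m ]) (coeff-below d (single 1#) m)

  euler-ι : ∀ r → euler (ι r) 𝕃.≈ 𝕃.0#
  euler-ι r e = begin
    [ e ] euler (ι r)       ≈⟨ coeff-euler e (ι r) ⟩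
    ⟦ e ⟧ᶻ * [ e ] ι r      ≡⟨ ≡.cong (⟦ e ⟧ᶻ *_) (coeff-const e r) ⟩
    ⟦ e ⟧ᶻ * single r ‼ e   ≈⟨ go e ⟩
    0#                      ≈⟨ coeff-0 e ⟨
    [ e ] 𝕃.0#              ∎
    where
    go : ∀ e → ⟦ e ⟧ᶻ * single r ‼ e ≈ 0#
    go (+ zero)  = zeroˡ r
    go (+ suc m) = zeroʳ _
    go -[1+ m ]  = zeroʳ _

  0≈0*l*f : ∀ l f → 𝕃.0# 𝕃.≈ 𝕃.0# 𝕃.* l 𝕃.* f
  0≈0*l*f = Z.solve 2 (λ l f → Z.con 0ℤ Z.:= Z.con 0ℤ Z.:* l Z.:* f) (λ _ → refl)

  module _ {D : Carrier → Carrier} (D-isDerivation : IsDerivation D) where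
    open Coefficientwise D-isDerivation
    private module D = IsDerivation D-isDerivation

    coeffwise-monomial : ∀ d → coeffwise (monomial rawRing d) 𝕃.≈ 𝕃.0#
    coeffwise-monomial d e = begin
      [ e ] coeffwise (monomial rawRing d)   ≈⟨ coeff-coeffwise e (monomial rawRing d) ⟩
      D ([ e ] monomial rawRing d)           ≡⟨ ≡.cong D (coeff≡‼ e (monomial rawRing d)) ⟩
      D (single 1# ‼ (e ℤ.- d))              ≈⟨ go (e ℤ.- d) ⟩
      0#                                     ≈⟨ coeff-0 e ⟨
      [ e ] 𝕃.0#                             ∎
      where
      go : ∀ k → D (single 1# ‼ k) ≈ 0#
      go (+ zero)  = D.D1≈0
      go (+ suc m) = D.0-homo
      go -[1+ m ]  = D.0-homo

    coeffwise-ι : ∀ r → coeffwise (ι r) 𝕃.≈ ι (D r)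
    coeffwise-ι r e = begin
      [ e ] coeffwise (ι r)   ≈⟨ coeff-coeffwise e (ι r) ⟩
      D ([ e ] ι r)           ≡⟨ ≡.cong D (coeff-const e r) ⟩
      D (single r ‼ e)        ≈⟨ go e ⟩
      single (D r) ‼ e        ≡⟨ coeff-const e (D r) ⟨
      [ e ] ι (D r)           ∎
      where
      go : ∀ k → D (single r ‼ k) ≈ single (D r) ‼ k
      go (+ zero)  = refl
      go (+ suc m) = D.0-homo
      go -[1+ m ]  = D.0-homo

    log-coeffwise-ι : ∀ {f l} → Derivations.LogDerivative R D f l →
                      D𝕃.LogDerivative coeffwise (ι f) (ι l)
    log-coeffwise-ι {f} {l} p e = begin
      [ e ] coeffwise (ι f)  ≈⟨ coeffwise-ι f e ⟩
      [ e ] ι (D f)          ≈⟨ Dι.cong p e ⟩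
      [ e ] ι (l * f)        ≈⟨ ι-* l f e ⟩
      [ e ] (ι l 𝕃.* ι f)    ∎

  ι-⟦⟧ : ∀ p → ι ⟦ p ⟧ᶻ 𝕃.≈ Z.⟦ p ⟧ᶻ
  ι-⟦⟧ p e = begin
    [ e ] ι ⟦ p ⟧ᶻ             ≈⟨ Dι.cong (*-identityʳ _) e ⟨
    [ e ] ι (⟦ p ⟧ᶻ * 1#)      ≈⟨ Dι.⟦⟧-homo p 1# e ⟩
    [ e ] (Z.⟦ p ⟧ᶻ 𝕃.* 𝕃.1#)  ≈⟨ C𝕃.*-identityʳ Z.⟦ p ⟧ᶻ e ⟩
    [ e ] Z.⟦ p ⟧ᶻ             ∎

  ι-*-⟦⟧ : ∀ r p → ι (r * ⟦ p ⟧ᶻ) 𝕃.≈ ι r 𝕃.* Z.⟦ p ⟧ᶻ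
  ι-*-⟦⟧ r p = C𝕃.trans {ι (r * ⟦ p ⟧ᶻ)} {ι r 𝕃.* ι ⟦ p ⟧ᶻ} {ι r 𝕃.* Z.⟦ p ⟧ᶻ} (ι-* r ⟦ p ⟧ᶻ)
    (C𝕃.*-congˡ {ι r} {ι ⟦ p ⟧ᶻ} {Z.⟦ p ⟧ᶻ} (ι-⟦⟧ p))

  ι-geometric : ∀ {r s g} → (1# - r * s) * g ≈ 1# → (𝕃.1# 𝕃.+ 𝕃.- (ι r 𝕃.* ι s)) 𝕃.* ι g 𝕃.≈ 𝕃.1#
  ι-geometric {r} {s} {g} p e = begin
    [ e ] ((𝕃.1# 𝕃.+ 𝕃.- (ι r 𝕃.* ι s)) 𝕃.* ι g)
      ≈⟨ C𝕃.*-congʳ {ι g} {ι (1# - r * s)} {𝕃.1# 𝕃.+ 𝕃.- (ι r 𝕃.* ι s)} ι-1-* e ⟨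
    [ e ] (ι (1# - r * s) 𝕃.* ι g)
      ≈⟨ ι-* (1# - r * s) g e ⟨
    [ e ] ι ((1# - r * s) * g)
      ≈⟨ Dι.cong p e ⟩
    [ e ] 𝕃.1#  ∎
    where
    ι-1-* : ι (1# - r * s) 𝕃.≈ 𝕃.1# 𝕃.+ 𝕃.- (ι r 𝕃.* ι s)
    ι-1-* e = begin
      [ e ] ι (1# - r * s)                         ≈⟨ Dι.+-homo 1# (- (r * s)) e ⟩
      [ e ] (𝕃.1# 𝕃.+ ι (- (r * s)))               ≈⟨ coeff-+ e 𝕃.1# (ι (- (r * s))) ⟩
      [ e ] 𝕃.1# + [ e ] ι (- (r * s))             ≈⟨ +-congˡ (Dι.-‿homo (r * s) e) ⟩
      [ e ] 𝕃.1# + [ e ] (𝕃.- ι (r * s))           ≈⟨ +-congˡ (C𝕃.-‿cong {ι (r * s)} {ι r 𝕃.* ι s} (ι-* r s) e) ⟩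
      [ e ] 𝕃.1# + [ e ] (𝕃.- (ι r 𝕃.* ι s))       ≈⟨ coeff-+ e 𝕃.1# (𝕃.- (ι r 𝕃.* ι s)) ⟨
      [ e ] (𝕃.1# 𝕃.+ 𝕃.- (ι r 𝕃.* ι s))           ∎

-- The iterated series rings, their derivations and their basic elements

isCommutativeRing : ∀ n → let open RawRing (L n) in IsCommutativeRing _≈_ _+_ _*_ -_ 0# 1#
isCommutativeRing zero    = ℚₚ.+-*-isCommutativeRing
isCommutativeRing (suc n) =
  LaurentRing.isCommutativeRing′ (record { isCommutativeRing = isCommutativeRing n })

seriesRing : ℕ → CommutativeRing 0ℓ 0ℓ
seriesRing n = record { isCommutativeRing = isCommutativeRing n }

-- x_k ∂/∂x_k
θ : ∀ {n} → Fin n → Series n → Series n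
θ {suc n} zero    = LaurentDerivations.euler (seriesRing n)
θ {suc n} (suc k) = LaurentDerivations.gradedMap (seriesRing n) (λ _ → θ k)

θ-isDerivation : ∀ {n} (k : Fin n) → Derivations.IsDerivation (seriesRing n) (θ k)
θ-isDerivation {suc n} zero    = LaurentDerivations.euler-isDerivation (seriesRing n)
θ-isDerivation {suc n} (suc k) =
  LaurentDerivations.Coefficientwise.coeffwise-isDerivation (seriesRing n) (θ-isDerivation k)

CT-isAdditive : ∀ n → IsAdditive (seriesRing n) (seriesRing 0) (CT n)
CT-isAdditive zero    = record { cong = λ p → p ; +-homo = λ _ _ → ≡.refl }
CT-isAdditive (suc n) = record
  { cong   = λ p → CTₙ.cong (p 0ℤ)
  ; +-homo = λ s u → ≡.trans (CTₙ.cong (LaurentRing.coeff-+ (seriesRing n) 0ℤ s u)) (CTₙ.+-homo _ _)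
  }
  where module CTₙ = IsAdditive (CT-isAdditive n)

-- For the outermost variable, x ∂/∂x multiplies the coefficient at exponent 0 by 0. For an inner
-- variable it acts inside the coefficients, hence commutes with extracting the outer one, and the
-- induction continues.
CT-θ : ∀ {n} (k : Fin n) s → CT n (θ k s) ≡ 0ℚ
CT-θ {suc n} zero s =
  ≡.trans (CTₙ.cong (trans (LaurentDerivations.coeff-euler (seriesRing n) 0ℤ s) (zeroˡ (coeff (L n) 0ℤ s)))) CTₙ.0-homo
  where
  module CTₙ = IsAdditive (CT-isAdditive n)
  open CommutativeRing (seriesRing n)
CT-θ {suc n} (suc k) s =
  ≡.trans (IsAdditive.cong (CT-isAdditive n)
    (LaurentDerivations.Coefficientwise.coeff-coeffwise (seriesRing n) (θ-isDerivation k) 0ℤ s))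
    (CT-θ k (coeff (L n) 0ℤ s))

module 𝕊 (n : ℕ) where
  open CommutativeRing (seriesRing n) public hiding (zero)
  open FiniteSums (seriesRing n) public using (δ)
  open Derivations (seriesRing n) public using (LogDerivative)
  open IntegerSolver (seriesRing n) public using (⟦_⟧ᶻ)

ι-δ : ∀ n {m} (k i : Fin m) → const (L n) (𝕊.δ n k i) ≡ 𝕊.δ (suc n) k i
ι-δ n zero    zero    = ≡.refl
ι-δ n zero    (suc i) = ≡.refl
ι-δ n (suc k) zero    = ≡.refl
ι-δ n (suc k) (suc i) = ι-δ n k i

log-varPow : ∀ {n} (k i : Fin n) d → let open 𝕊 n in
  LogDerivative (θ k) (varPow i d) (δ k i * ⟦ d ⟧ᶻ)
log-varPow {suc n} zero zero d =
  trans {θ {suc n} zero v} {⟦ d ⟧ᶻ * v} {1# * ⟦ d ⟧ᶻ * v} (euler-monomial d)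
    (*-congʳ {v} {⟦ d ⟧ᶻ} {1# * ⟦ d ⟧ᶻ} (sym {1# * ⟦ d ⟧ᶻ} {⟦ d ⟧ᶻ} (*-identityˡ ⟦ d ⟧ᶻ)))
  where
  open 𝕊 (suc n)
  open MonomialsAndConstants (seriesRing n)
  v = varPow {suc n} zero d
log-varPow {suc n} zero (suc i) d =
  trans {θ {suc n} zero v} {0#} {0# * ⟦ d ⟧ᶻ * v} (euler-ι (varPow i d)) (0≈0*l*f ⟦ d ⟧ᶻ v)
  where
  open 𝕊 (suc n)
  open MonomialsAndConstants (seriesRing n)
  v = varPow (suc i) d
log-varPow {suc n} (suc k) zero d =
  trans {θ (suc k) v} {0#} {0# * ⟦ d ⟧ᶻ * v} (coeffwise-monomial (θ-isDerivation k) d) (0≈0*l*f ⟦ d ⟧ᶻ v)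
  where
  open 𝕊 (suc n)
  open MonomialsAndConstants (seriesRing n)
  v = varPow {suc n} zero d
log-varPow {suc n} (suc k) (suc i) d =
  ≡.subst (λ z → LogDerivative (θ (suc k)) v (z * ⟦ d ⟧ᶻ)) (ι-δ n k i)
    (trans {θ (suc k) v} {ι (𝕊.δ n k i 𝕊ₙ.* 𝕊ₙ.⟦ d ⟧ᶻ) * v} {ι (𝕊.δ n k i) * ⟦ d ⟧ᶻ * v}
      (log-coeffwise-ι (θ-isDerivation k) (log-varPow k i d))
      (*-congʳ {v} {ι (𝕊.δ n k i 𝕊ₙ.* 𝕊ₙ.⟦ d ⟧ᶻ)} {ι (𝕊.δ n k i) * ⟦ d ⟧ᶻ} (ι-*-⟦⟧ (𝕊.δ n k i) d)))
  where
  module 𝕊ₙ = 𝕊 n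
  open 𝕊 (suc n)
  open LaurentDerivations (seriesRing n) using (ι)
  open MonomialsAndConstants (seriesRing n)
  v = varPow (suc i) d

varPow-0 : ∀ {n} (i : Fin n) → let open 𝕊 n in varPow i 0ℤ ≈ 1#
varPow-0 {suc n} zero    = 𝕊.refl (suc n) {𝕊.1# (suc n)}
varPow-0 {suc n} (suc i) = IsAdditive.cong (LaurentDerivations.ι-isAdditive (seriesRing n)) (varPow-0 i)

varPow-+ : ∀ {n} (i : Fin n) d e → let open 𝕊 n in
  varPow i (d ℤ.+ e) ≈ varPow i d * varPow i e
varPow-+ {suc n} zero    d e = LaurentDerivations.monomial-+ (seriesRing n) d e
varPow-+ {suc n} (suc i) d e =
  trans {varPow (suc i) (d ℤ.+ e)} {ι (varPow i d 𝕊ₙ.* varPow i e)} {varPow (suc i) d * varPow (suc i) e}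
    (IsAdditive.cong ι-isAdditive (varPow-+ i d e)) (ι-* (varPow i d) (varPow i e))
  where
  module 𝕊ₙ = 𝕊 n
  open 𝕊 (suc n)
  open LaurentDerivations (seriesRing n) using (ι; ι-*; ι-isAdditive)

-- The factor `1#` keeps the shape 1 - x a of `geometric` at a = 1, which `ι-geometric` then lifts
-- past each further outer variable.
geom-inverse : ∀ {n} (i : Fin n) → let open 𝕊 n in
  (1# - varPow i 1ℤ * 1#) * geom i ≈ 1#
geom-inverse {suc n} zero    =
  LaurentDerivations.geometric (seriesRing n) 1# (λ _ → 1#) refl (λ _ → sym (*-identityˡ 1#))
  where open 𝕊 n
geom-inverse {suc n} (suc i) = MonomialsAndConstants.ι-geometric (seriesRing n) (geom-inverse i)

geomRatio-inverse : ∀ {n} (i j : Fin n) (i<j : i < j) → let open 𝕊 n in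
  (1# - varPow i 1ℤ * varPow j (ℤ.- 1ℤ)) * geomRatio i j i<j ≈ 1#
geomRatio-inverse {suc n} zero (suc j) _ = LaurentDerivations.geometric (seriesRing n)
  (varPow j (ℤ.- 1ℤ)) (λ m → varPow j (ℤ.- + m)) (varPow-0 j)
  (λ m → trans (reflexive (≡.cong (varPow j) (ℤₚ.neg-distrib-+ 1ℤ (+ m)))) (varPow-+ j (ℤ.- 1ℤ) (ℤ.- + m)))
  where open 𝕊 n
geomRatio-inverse {suc n} (suc i) (suc j) (s≤s i<j) =
  MonomialsAndConstants.ι-geometric (seriesRing n) (geomRatio-inverse i j i<j)

-- The integrand at t = 0

module Integrand (n a b c : ℕ) where
  open 𝕊 n
  open Derivations (seriesRing n) hiding (LogDerivative)
  open FiniteSums (seriesRing n) hiding (δ)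
  open IntegerSolver (seriesRing n) using (solve; _:=_; _:+_; _:*_; _:-_; :-_; con; ⟦-⟧)
  open import Algebra.Properties.Semiring.Sum semiring
  open import Algebra.Definitions.RawSemiring (RawRing.rawSemiring rawRing) using (product; _^_)
  open import Relation.Binary.Reasoning.Setoid setoid

  x x⁻¹ y : Fin n → Carrier
  x i   = varPow i 1ℤ
  x⁻¹ i = varPow i (ℤ.- 1ℤ)
  y     = x/[1-x] n

  x*x⁻¹ : ∀ i → x i * x⁻¹ i ≈ 1#
  x*x⁻¹ i = trans (sym (varPow-+ i 1ℤ (ℤ.- 1ℤ))) (varPow-0 i)

  -- This is y (1 - x) = x, the only relation between x and y that the abstract argument receives.
  y≈x+yx : ∀ i → y i ≈ x i + y i * x i
  y≈x+yx i = begin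
    x i * g                             ≈⟨ solve 2 (λ x g → x :* g := x :* ((con 1ℤ :- x :* con 1ℤ) :* g) :+ x :* g :* x) refl (x i) g ⟩
    x i * ((1# - x i * 1#) * g) + y i * x i  ≈⟨ +-congʳ (*-congˡ (geom-inverse i)) ⟩
    x i * 1# + y i * x i                ≈⟨ +-congʳ (*-identityʳ _) ⟩
    x i + y i * x i                     ∎
    where g = geom i

  log-geom : ∀ k i → LogDerivative (θ k) (geom i) (δ k i * y i)
  log-geom k i = log-cong (θ-isDerivation k) refl
    (solve 3 (λ d x g → (d :* con 1ℤ :+ con 0ℤ) :* (x :* con 1ℤ :* g) := d :* (x :* g)) refl (δ k i) (x i) (geom i))
    (log-geometric (θ-isDerivation k) (geom-inverse i)
      (log-* (θ-isDerivation k) (log-varPow k i 1ℤ) (log-1 (θ-isDerivation k))))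

  -- For k = i this is x / (1 - x)², and 1 / (1 - x) = 1 + y.
  θ-y : ∀ k i → θ k (y i) ≈ δ k i * ((1# + y i) * y i)
  θ-y k i = trans (log-* (θ-isDerivation k) (log-varPow k i 1ℤ) (log-geom k i))
    (solve 2 (λ d y → (d :* con 1ℤ :+ d :* y) :* y := d :* ((con 1ℤ :+ y) :* y)) refl (δ k i) (y i))

  -- difference⁻¹ i j = (x_j - x_i)⁻¹ for i < j
  difference⁻¹ : Fin n → Fin n → Carrier
  difference⁻¹ i j with i <? j
  ... | yes i<j = x⁻¹ j * geomRatio i j i<j
  ... | no  _   = 0#

  difference-inverse : ∀ i j (i<j : i < j) → x j * (x⁻¹ j * geomRatio i j i<j) ≈ 1# + x i * (x⁻¹ j * geomRatio i j i<j)
  difference-inverse i j i<j = begin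
    x j * (x⁻¹ j * g)
      ≈⟨ *-assoc _ _ _ ⟨
    x j * x⁻¹ j * g
      ≈⟨ trans (*-congʳ (x*x⁻¹ j)) (*-identityˡ g) ⟩
    g
      ≈⟨ solve 3 (λ x x′ g → g := (con 1ℤ :- x :* x′) :* g :+ x :* (x′ :* g)) refl (x i) (x⁻¹ j) g ⟩
    (1# - x i * x⁻¹ j) * g + x i * (x⁻¹ j * g)
      ≈⟨ +-congʳ (geomRatio-inverse i j i<j) ⟩
    1# + x i * (x⁻¹ j * g)  ∎
    where g = geomRatio i j i<j

  -- For i < j the two factors of the edge contribute -c δ_kj and c (δ_ki - δ_kj) x_i / (x_j - x_i);
  -- the first is absorbed by x_j / (x_j - x_i) = 1 + x_i / (x_j - x_i). When i < j fails, the edge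
  -- is 1 and `difference⁻¹` is 0, so the same formula holds.
  log-edgeFactor : ∀ k i j → LogDerivative (θ k) (edgeFactor n c i j)
    (⟦ + c ⟧ᶻ * (δ k i * (x i * difference⁻¹ i j) - δ k j * (x j * difference⁻¹ i j)))
  log-edgeFactor k i j with i <? j
  ... | no  _   = log-cong (θ-isDerivation k) refl
    (solve 5 (λ c d x d′ x′ → con 0ℤ := c :* (d :* (x :* con 0ℤ) :- d′ :* (x′ :* con 0ℤ))) refl
      ⟦ + c ⟧ᶻ (δ k i) (x i) (δ k j) (x j))
    (log-1 (θ-isDerivation k))
  ... | yes i<j = log-cong (θ-isDerivation k) refl
    (begin
      δ k j * ⟦ ℤ.- + c ⟧ᶻ + ⟦ + c ⟧ᶻ * ((δ k i * 1# + δ k j * - 1#) * (x i * x⁻¹ j * g))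
        ≈⟨ +-congʳ (*-congˡ (⟦-⟧ (+ c))) ⟩
      δ k j * - ⟦ + c ⟧ᶻ + ⟦ + c ⟧ᶻ * ((δ k i * 1# + δ k j * - 1#) * (x i * x⁻¹ j * g))
        ≈⟨ solve 6 (λ c d d′ x x′ g →
              d′ :* (:- c) :+ c :* ((d :* con 1ℤ :+ d′ :* (:- con 1ℤ)) :* (x :* x′ :* g)) :=
              c :* (d :* (x :* (x′ :* g)) :- d′ :* (con 1ℤ :+ x :* (x′ :* g)))) refl
              ⟦ + c ⟧ᶻ (δ k i) (δ k j) (x i) (x⁻¹ j) g ⟩
      ⟦ + c ⟧ᶻ * (δ k i * (x i * (x⁻¹ j * g)) - δ k j * (1# + x i * (x⁻¹ j * g)))
        ≈⟨ *-congˡ (+-congˡ (-‿cong (*-congˡ (difference-inverse i j i<j)))) ⟨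
      ⟦ + c ⟧ᶻ * (δ k i * (x i * (x⁻¹ j * g)) - δ k j * (x j * (x⁻¹ j * g)))  ∎)
    (log-* (θ-isDerivation k) (log-varPow k j (ℤ.- + c))
      (log-^ (θ-isDerivation k)
        (log-geometric (θ-isDerivation k) (geomRatio-inverse i j i<j)
          (log-* (θ-isDerivation k) (log-varPow k i 1ℤ) (log-varPow k j (ℤ.- 1ℤ)))) c))
    where g = geomRatio i j i<j

  -- q i j = (x_i - x_j)⁻¹ for i ≠ j
  q : Fin n → Fin n → Carrier
  q i j = difference⁻¹ j i - difference⁻¹ i j

  q-antisym : ∀ i j → q i j + q j i ≈ 0#
  q-antisym i j = solve 2 (λ p r → (p :- r) :+ (r :- p) := con 0ℤ) refl (difference⁻¹ j i) (difference⁻¹ i j)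

  difference⁻¹-< : ∀ i j → i < j → x j * difference⁻¹ i j ≈ 1# + x i * difference⁻¹ i j
  difference⁻¹-< i j i<j with i <? j
  ... | yes i<j′ = difference-inverse i j i<j′
  ... | no i≮j   = contradiction i<j i≮j

  difference⁻¹-≮ : ∀ i j → ¬ (i < j) → difference⁻¹ i j ≡ 0#
  difference⁻¹-≮ i j i≮j with i <? j
  ... | yes i<j = contradiction i<j i≮j
  ... | no _    = ≡.refl

  -- Off the diagonal this is (x_i - x_j) q = 1; on the diagonal q is 0 and `δ` supplies the 1. One
  -- equation for all pairs lets the double sums run over the full square, with the diagonal split
  -- off by `δ`.
  q-inverse : ∀ i j → x i * q i j + δ i j ≈ 1# + x j * q i j
  q-inverse i j with <-cmp i j
  ... | tri≈ _ ≡.refl _ = begin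
    x i * (d - d) + δ i i   ≡⟨ ≡.cong (λ e → x i * (d - d) + e) (δ-≡ i) ⟩
    x i * (d - d) + 1#      ≈⟨ +-comm _ _ ⟩
    1# + x i * (d - d)      ∎
    where d = difference⁻¹ i i
  ... | tri< i<j i≢j j≮i = begin
    x i * (difference⁻¹ j i - d) + δ i j   ≡⟨ ≡.cong₂ (λ p r → x i * (p - d) + r) (difference⁻¹-≮ j i j≮i) (δ-≢ i j i≢j) ⟩
    x i * (0# - d) + 0#                    ≈⟨ solve 2 (λ x d → x :* (con 0ℤ :- d) :+ con 0ℤ := con 1ℤ :- (con 1ℤ :+ x :* d)) refl (x i) d ⟩
    1# - (1# + x i * d)                    ≈⟨ +-congˡ (-‿cong (difference⁻¹-< i j i<j)) ⟨
    1# - x j * d                           ≈⟨ solve 2 (λ x d → con 1ℤ :- x :* d := con 1ℤ :+ x :* (con 0ℤ :- d)) refl (x j) d ⟩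
    1# + x j * (0# - d)                    ≡⟨ ≡.cong (λ p → 1# + x j * (p - d)) (difference⁻¹-≮ j i j≮i) ⟨
    1# + x j * (difference⁻¹ j i - d)      ∎
    where d = difference⁻¹ i j
  ... | tri> i≮j i≢j j<i = begin
    x i * (d - difference⁻¹ i j) + δ i j   ≡⟨ ≡.cong₂ (λ p r → x i * (d - p) + r) (difference⁻¹-≮ i j i≮j) (δ-≢ i j i≢j) ⟩
    x i * (d - 0#) + 0#                    ≈⟨ solve 2 (λ x d → x :* (d :- con 0ℤ) :+ con 0ℤ := x :* d) refl (x i) d ⟩
    x i * d                                ≈⟨ difference⁻¹-< j i j<i ⟩
    1# + x j * d                           ≈⟨ solve 2 (λ x d → con 1ℤ :+ x :* d := con 1ℤ :+ x :* (d :- con 0ℤ)) refl (x j) d ⟩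
    1# + x j * (d - 0#)                    ≡⟨ ≡.cong (λ p → 1# + x j * (d - p)) (difference⁻¹-≮ i j i≮j) ⟨
    1# + x j * (d - difference⁻¹ i j)      ∎
    where d = difference⁻¹ j i

  -- Edges with smaller end k give x_k / (x_j - x_k), edges with larger end k give -x_k / (x_k -
  -- x_i). Both are -x_k times an entry of `q k`, so the order of the variables drops out of the
  -- formula.
  log-edgeProduct : ∀ k → LogDerivative (θ k) (edgeProduct n c) (- (⟦ + c ⟧ᶻ * (x k * sum (q k))))
  log-edgeProduct k = log-cong (θ-isDerivation k) refl
    (begin
      sum (λ i → sum (λ j → ⟦ + c ⟧ᶻ * (out i j - into i j)))
        ≈⟨ sum-cong-≋ (λ i → trans (sym (*-distribˡ-sum ⟦ + c ⟧ᶻ (λ j → out i j - into i j))) (*-congˡ (sum-sub (out i) (into i)))) ⟩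
      sum (λ i → ⟦ + c ⟧ᶻ * (sum (out i) - sum (into i)))
        ≈⟨ *-distribˡ-sum ⟦ + c ⟧ᶻ (λ i → sum (out i) - sum (into i)) ⟨
      ⟦ + c ⟧ᶻ * sum (λ i → sum (out i) - sum (into i))
        ≈⟨ *-congˡ (sum-sub (λ i → sum (out i)) (λ i → sum (into i))) ⟩
      ⟦ + c ⟧ᶻ * (sum (λ i → sum (out i)) - sum (λ i → sum (into i)))
        ≈⟨ *-congˡ (+-cong sum-out (-‿cong sum-into)) ⟩
      ⟦ + c ⟧ᶻ * (x k * sum (difference⁻¹ k) - x k * sum (λ i → difference⁻¹ i k))
        ≈⟨ solve 4 (λ c x p r → c :* (x :* p :- x :* r) := :- (c :* (x :* (r :- p)))) refl
             ⟦ + c ⟧ᶻ (x k) (sum (difference⁻¹ k)) (sum (λ i → difference⁻¹ i k)) ⟩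
      - (⟦ + c ⟧ᶻ * (x k * (sum (λ i → difference⁻¹ i k) - sum (difference⁻¹ k))))
        ≈⟨ -‿cong (*-congˡ (*-congˡ (sum-sub (λ i → difference⁻¹ i k) (difference⁻¹ k)))) ⟨
      - (⟦ + c ⟧ᶻ * (x k * sum (q k)))  ∎)
    (log-product (θ-isDerivation k) (λ i → log-product (θ-isDerivation k) (log-edgeFactor k i)))
    where
    out into : Fin n → Fin n → Carrier
    out  i j = δ k i * (x i * difference⁻¹ i j)
    into i j = δ k j * (x j * difference⁻¹ i j)
    sum-out : sum (λ i → sum (out i)) ≈ x k * sum (difference⁻¹ k)
    sum-out = begin
      sum (λ i → sum (out i))
        ≈⟨ sum-cong-≋ (λ i → trans (sym (*-distribˡ-sum (δ k i) (λ j → x i * difference⁻¹ i j)))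
             (*-congˡ (sym (*-distribˡ-sum (x i) (difference⁻¹ i))))) ⟩
      sum (λ i → δ k i * (x i * sum (difference⁻¹ i)))
        ≈⟨ sum-δ k (λ i → x i * sum (difference⁻¹ i)) ⟩
      x k * sum (difference⁻¹ k)  ∎
    sum-into : sum (λ i → sum (into i)) ≈ x k * sum (λ i → difference⁻¹ i k)
    sum-into = begin
      sum (λ i → sum (into i))               ≈⟨ sum-cong-≋ (λ i → sum-δ k (λ j → x j * difference⁻¹ i j)) ⟩
      sum (λ i → x k * difference⁻¹ i k)     ≈⟨ *-distribˡ-sum (x k) (λ i → difference⁻¹ i k) ⟨
      x k * sum (λ i → difference⁻¹ i k)     ∎

  F : Carrier
  F = product (vertexFactor n a b) * edgeProduct n c

  log-F : ∀ k → LogDerivative (θ k) F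
    (⟦ + b ⟧ᶻ * y k + ⟦ ℤ.- + a ℤ.+ 1ℤ ⟧ᶻ - ⟦ + c ⟧ᶻ * (x k * sum (q k)))
  log-F k = log-cong (θ-isDerivation k) refl (+-congʳ (begin
      sum (λ i → ⟦ + b ⟧ᶻ * (δ k i * y i) + δ k i * d)
        ≈⟨ sum-cong-≋ (λ i → solve 4 (λ b e y d → b :* (e :* y) :+ e :* d := e :* (b :* y :+ d)) refl ⟦ + b ⟧ᶻ (δ k i) (y i) d) ⟩
      sum (λ i → δ k i * (⟦ + b ⟧ᶻ * y i + d))
        ≈⟨ sum-δ k (λ i → ⟦ + b ⟧ᶻ * y i + d) ⟩
      ⟦ + b ⟧ᶻ * y k + d  ∎))
    (log-* (θ-isDerivation k)
      (log-product (θ-isDerivation k) (λ i → log-* (θ-isDerivation k)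
        (log-^ (θ-isDerivation k) (log-geom k i) b) (log-varPow k i (ℤ.- + a ℤ.+ 1ℤ))))
      (log-edgeProduct k))
    where d = ⟦ ℤ.- + a ℤ.+ 1ℤ ⟧ᶻ

-- The sum of total derivatives

module _ (R S : CommutativeRing 0ℓ 0ℓ) where
  private
    module R where
      open CommutativeRing R hiding (zero) public
      open IntegerSolver R using (⟦_⟧ᶻ) public
      open Derivations R using (LogDerivative) public
      open FiniteSums R using (δ) public
      open import Algebra.Properties.Semiring.Sum semiring using (sum) public
    open CommutativeRing S hiding (zero)
    open Derivations S using (IsDerivation)

  -- φ is the inclusion of the series in the x_i into its extension by t, D₀ k and D k
  -- are x_k ∂/∂x_k, T is t ∂/∂t, q i j = (x_i - x_j)⁻¹ for i ≠ j, h i = (1 + t y_i)⁻¹,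
  -- and F is the integrand at t = 0.
  record AomotoData (n : ℕ) : Set where
    field
      φ            : R.Carrier → Carrier
      φ-isAdditive : IsAdditive R S φ
      φ-*          : ∀ r s → φ (r R.* s) ≈ φ r * φ s
      φ-1          : φ R.1# ≈ 1#

      D₀             : Fin n → R.Carrier → R.Carrier
      D              : Fin n → Carrier → Carrier
      D-isDerivation : ∀ k → IsDerivation (D k)
      D-φ            : ∀ k r → D k (φ r) ≈ φ (D₀ k r)
      T              : Carrier → Carrier
      T-isDerivation : IsDerivation T
      T-φ            : ∀ r → T (φ r) ≈ 0#

      t   : Carrier
      D-t : ∀ k → D k t ≈ 0#
      T-t : T t ≈ t

      x y       : Fin n → R.Carrier
      y≈x+yx    : ∀ i → y i R.≈ x i R.+ y i R.* x i
      D₀-y      : ∀ k i → D₀ k (y i) R.≈ R.δ k i R.* ((R.1# R.+ y i) R.* y i)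
      q         : Fin n → Fin n → R.Carrier
      q-antisym : ∀ i j → q i j R.+ q j i R.≈ R.0#
      q-inverse : ∀ i j → x i R.* q i j R.+ R.δ i j R.≈ R.1# R.+ x j R.* q i j
      h         : Fin n → Carrier
      h-inverse : ∀ i → (1# + t * φ (y i)) * h i ≈ 1#

      β α γ : ℤ
      F     : R.Carrier
      log-F : ∀ k → R.LogDerivative (D₀ k) F
        (R.⟦ β ⟧ᶻ R.* y k R.+ R.⟦ α ⟧ᶻ R.- R.⟦ γ ⟧ᶻ R.* (x k R.* R.sum (q k)))

module Aomoto (R S : CommutativeRing 0ℓ 0ℓ) {n : ℕ} (aomotoData : AomotoData R S n) where
  open AomotoData aomotoData
  private
    module R where
      open CommutativeRing R hiding (zero) public
      open IntegerSolver R using (⟦_⟧ᶻ) public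
      open Derivations R using (LogDerivative) public
      open FiniteSums R using (δ) public
      open import Algebra.Properties.Semiring.Sum semiring using (sum) public
      open import Algebra.Definitions.RawSemiring (RawRing.rawSemiring rawRing) using (product) public
    module φ = IsAdditive φ-isAdditive
  open CommutativeRing S hiding (zero)
  open Derivations S
  open FiniteSums S
  open IntegerSolver S using (solve; _:=_; _:+_; _:*_; _:-_; :-_; con; ⟦_⟧ᶻ)
  open import Algebra.Properties.Semiring.Sum semiring
  open import Algebra.Properties.AbelianGroup +-abelianGroup using (inverseʳ-unique)
  open import Algebra.Properties.Monoid.Mult.TCOptimised +-monoid using (×ᵤ≈×)
  open import Algebra.Definitions.RawSemiring (RawRing.rawSemiring rawRing) using (product)
  open import Relation.Binary.Reasoning.Setoid setoid

  -- `u i` is the logarithmic derivative of `w i` under `T`, and also 1 minus the reciprocal `h i`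
  -- of `w i`.
  X Y w u : Fin n → Carrier
  X i = φ (x i)
  Y i = φ (y i)
  w i = 1# + t * Y i
  u i = t * Y i * h i

  Q : Fin n → Fin n → Carrier
  Q i j = φ (q i j)

  -- Here `a` is the image of the exponent of x_i in the integrand, so in the application it stands
  -- for 1 - a; this is why `- a` shows up in the recurrence.
  b a c ν : Carrier
  b = ⟦ β ⟧ᶻ
  a = ⟦ α ⟧ᶻ
  c = ⟦ γ ⟧ᶻ
  ν = ⟦ + n ⟧ᶻ

  φ-δ : ∀ {m} (i j : Fin m) → φ (R.δ i j) ≈ δ i j
  φ-δ zero    zero    = φ-1
  φ-δ zero    (suc j) = φ.0-homo
  φ-δ (suc i) zero    = φ.0-homo
  φ-δ (suc i) (suc j) = φ-δ i j

  φ-⟦⟧ : ∀ p r → φ (R.⟦ p ⟧ᶻ R.* r) ≈ ⟦ p ⟧ᶻ * φ r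
  φ-⟦⟧ = φ.⟦⟧-homo

  φ-⟦⟧1 : ∀ p → φ R.⟦ p ⟧ᶻ ≈ ⟦ p ⟧ᶻ
  φ-⟦⟧1 p = begin
    φ R.⟦ p ⟧ᶻ             ≈⟨ φ.cong (R.*-identityʳ _) ⟨
    φ (R.⟦ p ⟧ᶻ R.* R.1#)  ≈⟨ φ-⟦⟧ p R.1# ⟩
    ⟦ p ⟧ᶻ * φ R.1#        ≈⟨ *-congˡ φ-1 ⟩
    ⟦ p ⟧ᶻ * 1#            ≈⟨ *-identityʳ _ ⟩
    ⟦ p ⟧ᶻ                 ∎

  Y≈X+YX : ∀ i → Y i ≈ X i + Y i * X i
  Y≈X+YX i = trans (φ.cong (y≈x+yx i)) (trans (φ.+-homo _ _) (+-congˡ (φ-* _ _)))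

  Q-antisym : ∀ i j → Q j i ≈ - Q i j
  Q-antisym i j = inverseʳ-unique (Q i j) (Q j i)
    (trans (sym (φ.+-homo _ _)) (trans (φ.cong (q-antisym i j)) φ.0-homo))

  Q-inverse : ∀ i j → X i * Q i j + δ i j ≈ 1# + X j * Q i j
  Q-inverse i j = begin
    X i * Q i j + δ i j                ≈⟨ +-cong (φ-* _ _) (φ-δ i j) ⟨
    φ (x i R.* q i j) + φ (R.δ i j)    ≈⟨ φ.+-homo _ _ ⟨
    φ (x i R.* q i j R.+ R.δ i j)      ≈⟨ φ.cong (q-inverse i j) ⟩
    φ (R.1# R.+ x j R.* q i j)         ≈⟨ φ.+-homo _ _ ⟩
    φ R.1# + φ (x j R.* q i j)         ≈⟨ +-cong φ-1 (φ-* _ _) ⟩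
    1# + X j * Q i j                   ∎

  ℓ : Fin n → Carrier
  ℓ k = b * Y k + a - c * (X k * sum (Q k))

  log-φF : ∀ k → LogDerivative (D k) (φ F) (ℓ k)
  log-φF k = begin
    D k (φ F)   ≈⟨ D-φ k F ⟩
    φ (D₀ k F)  ≈⟨ φ.cong (log-F k) ⟩
    φ (_ R.* F) ≈⟨ φ-* _ _ ⟩
    φ _ * φ F   ≈⟨ *-congʳ (trans (φ.+-homo _ _) (+-cong
      (trans (φ.+-homo _ _) (+-cong (φ-⟦⟧ β (y k)) (φ-⟦⟧1 α)))
      (trans (φ.-‿homo _) (-‿cong (trans (φ-⟦⟧ γ _) (*-congˡ (trans (φ-* _ _) (*-congˡ (φ.sum-homo (q k)))))))))) ⟩
    ℓ k * φ F   ∎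

  h≈1-u : ∀ i → h i ≈ 1# - u i
  h≈1-u i = begin
    h i                      ≈⟨ solve 3 (λ t y h → h := (con 1ℤ :+ t :* y) :* h :- t :* y :* h) refl t (Y i) (h i) ⟩
    w i * h i - u i          ≈⟨ +-congʳ (h-inverse i) ⟩
    1# - u i                 ∎

  log-by-inverse : ∀ E {f g} → f * g ≈ 1# → LogDerivative E f (E f * g)
  log-by-inverse E {f} {g} fg≈1 = begin
    E f            ≈⟨ *-identityʳ _ ⟨
    E f * 1#       ≈⟨ *-congˡ fg≈1 ⟨
    E f * (f * g)  ≈⟨ solve 3 (λ e f g → e :* (f :* g) := e :* g :* f) refl (E f) f g ⟩
    E f * g * f    ∎

  P G : Carrier
  P = product w
  G = φ F * P

  μ : Fin n → Carrier
  μ k = t * ((1# + Y k) * Y k) * h k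

  D-w : ∀ k i → D k (w i) * h i ≈ δ k i * μ i
  D-w k i = begin
    D k (1# + t * Y i) * h i
      ≈⟨ *-congʳ (trans (D.+-homo 1# _) (+-cong D.D1≈0 (D.leibniz t (Y i)))) ⟩
    (0# + (D k t * Y i + t * D k (Y i))) * h i
      ≈⟨ *-congʳ (+-congˡ (+-cong (*-congʳ (D-t k)) (*-congˡ D-Y))) ⟩
    (0# + (0# * Y i + t * (δ k i * ((1# + Y i) * Y i)))) * h i
      ≈⟨ solve 4 (λ t d y h → (con 0ℤ :+ (con 0ℤ :* y :+ t :* (d :* ((con 1ℤ :+ y) :* y)))) :* h :=
                              d :* (t :* ((con 1ℤ :+ y) :* y) :* h)) refl t (δ k i) (Y i) (h i) ⟩
    δ k i * μ i  ∎
    where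
    module D = IsDerivation (D-isDerivation k)
    D-Y : D k (Y i) ≈ δ k i * ((1# + Y i) * Y i)
    D-Y = begin
      D k (Y i)                                      ≈⟨ D-φ k (y i) ⟩
      φ (D₀ k (y i))                                 ≈⟨ φ.cong (D₀-y k i) ⟩
      φ (R.δ k i R.* ((R.1# R.+ y i) R.* y i))       ≈⟨ trans (φ-* _ _) (*-cong (φ-δ k i) (φ-* _ _)) ⟩
      δ k i * (φ (R.1# R.+ y i) * Y i)               ≈⟨ *-congˡ (*-congʳ (trans (φ.+-homo _ _) (+-congʳ φ-1))) ⟩
      δ k i * ((1# + Y i) * Y i)                     ∎

  -- The factor h_k removes 1 + t y_k from G, so that h_k G / F does not involve x_k.
  log-hG : ∀ k → LogDerivative (D k) (h k * G) (ℓ k)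
  log-hG k = log-cong d refl
    (begin
      - (D k (w k) * h k) + (ℓ k + sum (λ i → D k (w i) * h i))
        ≈⟨ +-cong (-‿cong (D-w k k)) (+-congˡ (trans (sum-cong-≋ (D-w k)) (sum-δ k μ))) ⟩
      - (δ k k * μ k) + (ℓ k + μ k)
        ≈⟨ +-congʳ (-‿cong (trans (*-congʳ (reflexive (δ-≡ k))) (*-identityˡ _))) ⟩
      - μ k + (ℓ k + μ k)
        ≈⟨ solve 2 (λ m l → :- m :+ (l :+ m) := l) refl (μ k) (ℓ k) ⟩
      ℓ k  ∎)
    (log-* d (log-inverse d (h-inverse k))
      (log-* d (log-φF k) (log-product d (λ i → log-by-inverse (D k) (h-inverse i)))))
    where
    d = D-isDerivation k

  φ-product : ∀ {m} (f : Fin m → R.Carrier) → φ (R.product f) ≈ product (φ ∘ f)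
  φ-product {zero}  f = φ-1
  φ-product {suc m} f = trans (φ-* _ _) (*-congˡ (φ-product (f ∘ suc)))

  integrand≈G : ∀ (v : Fin n → R.Carrier) e → F ≡ R.product v R.* e →
                product (λ i → φ (v i) * w i) * φ e ≈ G
  integrand≈G v e F≡ve = begin
    product (λ i → φ (v i) * w i) * φ e   ≈⟨ *-congʳ (∑-distrib-* (φ ∘ v) w) ⟩
    product (φ ∘ v) * P * φ e             ≈⟨ *-congʳ (*-congʳ (φ-product v)) ⟨
    φ (R.product v) * P * φ e             ≈⟨ solve 3 (λ v p e → v :* p :* e := v :* e :* p) refl (φ (R.product v)) P (φ e) ⟩
    φ (R.product v) * φ e * P             ≈⟨ *-congʳ (φ-* (R.product v) e) ⟨
    φ (R.product v R.* e) * P             ≡⟨ ≡.cong (λ f → φ f * P) F≡ve ⟨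
    G                                     ∎
    where open import Algebra.Properties.CommutativeMonoid.Sum *-commutativeMonoid
            using () renaming (∑-distrib-+ to ∑-distrib-*)

  E U² : Carrier
  E  = sum u
  U² = sum (λ i → u i * u i)

  log-tY : ∀ i → LogDerivative T (t * Y i) 1#
  log-tY i = log-cong T-isDerivation refl (+-identityʳ 1#)
    (log-* T-isDerivation (trans T-t (sym (*-identityˡ t))) (trans (T-φ (y i)) (sym (zeroˡ _))))

  T-w : ∀ i → T (w i) ≈ t * Y i
  T-w i = begin
    T (1# + t * Y i)     ≈⟨ T′.+-homo _ _ ⟩
    T 1# + T (t * Y i)   ≈⟨ +-cong T′.D1≈0 (log-tY i) ⟩
    0# + 1# * (t * Y i)  ≈⟨ trans (+-identityˡ _) (*-identityˡ _) ⟩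
    t * Y i              ∎
    where module T′ = IsDerivation T-isDerivation

  log-G : LogDerivative T G E
  log-G = log-cong T-isDerivation refl
    (trans (+-identityˡ _) (sum-cong-≋ (λ i → *-congʳ (T-w i))))
    (log-* T-isDerivation (trans (T-φ F) (sym (zeroˡ _)))
      (log-product T-isDerivation (λ i → log-by-inverse T (h-inverse i))))

  T-E : T E ≈ E - U²
  T-E = begin
    T E                            ≈⟨ IsDerivation.sum-homo T-isDerivation u ⟩
    sum (λ i → T (u i))            ≈⟨ sum-cong-≋ T-u ⟩
    sum (λ i → u i - u i * u i)    ≈⟨ sum-sub u (λ i → u i * u i) ⟩
    E - U²                         ∎
    where
    T-u : ∀ i → T (u i) ≈ u i - u i * u i
    T-u i = begin
      T (u i)                              ≈⟨ log-* T-isDerivation (log-tY i) (log-inverse T-isDerivation (h-inverse i)) ⟩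
      (1# - T (w i) * h i) * u i           ≈⟨ *-congʳ (+-congˡ (-‿cong (*-congʳ (T-w i)))) ⟩
      (1# - u i) * u i                     ≈⟨ solve 1 (λ u → (con 1ℤ :- u) :* u := u :- u :* u) refl (u i) ⟩
      u i - u i * u i                      ∎

  TT-G : T (T G) ≈ (E - U² + E * E) * G
  TT-G = begin
    T (T G)                       ≈⟨ T′.cong log-G ⟩
    T (E * G)                     ≈⟨ T′.leibniz E G ⟩
    T E * G + E * T G             ≈⟨ +-cong (*-congʳ T-E) (*-congˡ log-G) ⟩
    (E - U²) * G + E * (E * G)    ≈⟨ solve 3 (λ e v g → (e :- v) :* g :+ e :* (e :* g) := (e :- v :+ e :* e) :* g) refl E U² G ⟩
    (E - U² + E * E) * G          ∎
    where module T′ = IsDerivation T-isDerivation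

  pair : Fin n → Fin n → Carrier
  pair i j = t * (h i * (X i * Q i j))

  -- Adding the terms (i , j) and (j , i) cancels the denominator x_i - x_j.
  pair-sym : ∀ i j → pair i j + pair j i ≈ (t * (h i * h j) - u i * u j) - δ i j * (t * (h i * h j) - u i * u j)
  pair-sym i j = begin
    t * (h i * (X i * Q i j)) + t * (h j * (X j * Q j i))
      ≈⟨ +-congˡ (*-congˡ (*-congˡ (*-congˡ (Q-antisym i j)))) ⟩
    t * (h i * (X i * Q i j)) + t * (h j * (X j * - Q i j))
      -- The inserted factors w_j h_j = 1 and w_i h_i = 1 give both terms the common factor h_i h_j.
      ≈⟨ +-cong (*-congˡ (unit (h-inverse j))) (*-congˡ (unit (h-inverse i))) ⟩
    t * (w j * h j * (h i * (X i * Q i j))) + t * (w i * h i * (h j * (X j * - Q i j)))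
      ≈⟨ solve 8 (λ t hᵢ hⱼ xᵢ xⱼ yᵢ yⱼ q →
           t :* ((con 1ℤ :+ t :* yⱼ) :* hⱼ :* (hᵢ :* (xᵢ :* q))) :+ t :* ((con 1ℤ :+ t :* yᵢ) :* hᵢ :* (hⱼ :* (xⱼ :* (:- q)))) :=
           t :* (hᵢ :* hⱼ) :* ((xᵢ :* q :- xⱼ :* q) :+ t :* q :* (xᵢ :* yⱼ :- xⱼ :* yᵢ))) refl
           t (h i) (h j) (X i) (X j) (Y i) (Y j) (Q i j) ⟩
    t * (h i * h j) * ((X i * Q i j - X j * Q i j) + t * Q i j * (X i * Y j - X j * Y i))
      -- The antisymmetric expression x_i y_j - x_j y_i is a multiple of x_i - x_j, so that `Q i j`
      -- now meets nothing but this difference.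
      ≈⟨ *-congˡ (+-congˡ (*-congˡ exchange)) ⟩
    t * (h i * h j) * ((X i * Q i j - X j * Q i j) + t * Q i j * (Y i * Y j * (X j - X i)))
      ≈⟨ solve 8 (λ t hᵢ hⱼ xᵢ xⱼ yᵢ yⱼ q →
           t :* (hᵢ :* hⱼ) :* ((xᵢ :* q :- xⱼ :* q) :+ t :* q :* (yᵢ :* yⱼ :* (xⱼ :- xᵢ))) :=
           (t :* (hᵢ :* hⱼ) :- t :* yᵢ :* hᵢ :* (t :* yⱼ :* hⱼ)) :* (xᵢ :* q :- xⱼ :* q)) refl
           t (h i) (h j) (X i) (X j) (Y i) (Y j) (Q i j) ⟩
    (t * (h i * h j) - u i * u j) * (X i * Q i j - X j * Q i j)
      ≈⟨ *-congˡ XQ ⟩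
    (t * (h i * h j) - u i * u j) * (1# - δ i j)
      ≈⟨ solve 2 (λ p d → p :* (con 1ℤ :- d) := p :- d :* p) refl (t * (h i * h j) - u i * u j) (δ i j) ⟩
    (t * (h i * h j) - u i * u j) - δ i j * (t * (h i * h j) - u i * u j)  ∎
    where
    unit : ∀ {p r} → p ≈ 1# → r ≈ p * r
    unit p≈1 = sym (trans (*-congʳ p≈1) (*-identityˡ _))
    XQ : X i * Q i j - X j * Q i j ≈ 1# - δ i j
    XQ = begin
      X i * Q i j - X j * Q i j                    ≈⟨ solve 3 (λ p r d → p :- r := (p :+ d) :- r :- d) refl (X i * Q i j) (X j * Q i j) (δ i j) ⟩
      (X i * Q i j + δ i j) - X j * Q i j - δ i j  ≈⟨ +-congʳ (+-congʳ (Q-inverse i j)) ⟩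
      (1# + X j * Q i j) - X j * Q i j - δ i j     ≈⟨ solve 2 (λ r d → (con 1ℤ :+ r) :- r :- d := con 1ℤ :- d) refl (X j * Q i j) (δ i j) ⟩
      1# - δ i j                                   ∎
    X-Y : ∀ i → X i ≈ Y i - Y i * X i
    X-Y i = begin
      X i                            ≈⟨ solve 2 (λ x y → x := (x :+ y :* x) :- y :* x) refl (X i) (Y i) ⟩
      X i + Y i * X i - Y i * X i    ≈⟨ +-congʳ (Y≈X+YX i) ⟨
      Y i - Y i * X i                ∎
    exchange : X i * Y j - X j * Y i ≈ Y i * Y j * (X j - X i)
    exchange = begin
      X i * Y j - X j * Y i
        ≈⟨ +-cong (*-congʳ (X-Y i)) (-‿cong (*-congʳ (X-Y j))) ⟩
      (Y i - Y i * X i) * Y j - (Y j - Y j * X j) * Y i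
        ≈⟨ solve 4 (λ xᵢ xⱼ yᵢ yⱼ → (yᵢ :- yᵢ :* xᵢ) :* yⱼ :- (yⱼ :- yⱼ :* xⱼ) :* yᵢ := yᵢ :* yⱼ :* (xⱼ :- xᵢ)) refl (X i) (X j) (Y i) (Y j) ⟩
      Y i * Y j * (X j - X i)  ∎

  sum-h : sum h ≈ ν - E
  sum-h = begin
    sum h                        ≈⟨ sum-cong-≋ h≈1-u ⟩
    sum (λ i → 1# - u i)         ≈⟨ sum-sub (λ _ → 1#) u ⟩
    sum {n} (λ _ → 1#) - E       ≈⟨ +-congʳ (trans (sum-replicate n) (×ᵤ≈× n 1#)) ⟩
    ν - E                        ∎

  sum-h² : sum (λ i → h i * h i) ≈ ν - E - (E - U²)
  sum-h² = begin
    sum (λ i → h i * h i)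
      ≈⟨ sum-cong-≋ (λ i → trans (*-cong (h≈1-u i) (h≈1-u i))
           (trans (solve 1 (λ u → (con 1ℤ :- u) :* (con 1ℤ :- u) := (con 1ℤ :- u) :- (u :- u :* u)) refl (u i))
             (+-congʳ (sym (h≈1-u i))))) ⟩
    sum (λ i → h i - (u i - u i * u i))
      ≈⟨ sum-sub h (λ i → u i - u i * u i) ⟩
    sum h - sum (λ i → u i - u i * u i)
      ≈⟨ +-cong sum-h (-‿cong (sum-sub u (λ i → u i * u i))) ⟩
    ν - E - (E - U²)  ∎

  ∑∑ : (Fin n → Fin n → Carrier) → Carrier
  ∑∑ f = sum (λ i → sum (f i))

  ∑∑-+ : ∀ f g → ∑∑ (λ i j → f i j + g i j) ≈ ∑∑ f + ∑∑ g
  ∑∑-+ f g = trans (sum-cong-≋ (λ i → ∑-distrib-+ (f i) (g i))) (∑-distrib-+ (λ i → sum (f i)) (λ i → sum (g i)))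

  ∑∑-sub : ∀ f g → ∑∑ (λ i j → f i j - g i j) ≈ ∑∑ f - ∑∑ g
  ∑∑-sub f g = trans (sum-cong-≋ (λ i → sum-sub (f i) (g i))) (sum-sub (λ i → sum (f i)) (λ i → sum (g i)))

  -- Adding the double sum to its transpose makes `pair-sym` applicable. The resulting 2 stays on
  -- the left, as `S` is an arbitrary commutative ring without a half. The full square factors into
  -- products of single sums, and the `δ` term subtracts its diagonal.
  sum-pairs : ⟦ + 2 ⟧ᶻ * ∑∑ pair ≈ t * ((ν - E) * (ν - E) - (ν - E - (E - U²))) - (E * E - U²)
  sum-pairs = begin
    ⟦ + 2 ⟧ᶻ * ∑∑ pair
      ≈⟨ solve 1 (λ p → con (+ 2) :* p := p :+ p) refl (∑∑ pair) ⟩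
    ∑∑ pair + ∑∑ pair
      ≈⟨ +-congˡ (∑-comm pair) ⟩
    ∑∑ pair + ∑∑ (λ i j → pair j i)
      ≈⟨ ∑∑-+ pair (λ i j → pair j i) ⟨
    ∑∑ (λ i j → pair i j + pair j i)
      ≈⟨ sum-cong-≋ (λ i → sum-cong-≋ (pair-sym i)) ⟩
    ∑∑ (λ i j → p i j - δ i j * p i j)
      ≈⟨ ∑∑-sub p (λ i j → δ i j * p i j) ⟩
    ∑∑ p - ∑∑ (λ i j → δ i j * p i j)
      ≈⟨ +-cong full (-‿cong diagonal) ⟩
    (t * ((ν - E) * (ν - E)) - E * E) - (t * (ν - E - (E - U²)) - U²)
      ≈⟨ solve 5 (λ t H E² H² U² → (t :* H :- E²) :- (t :* H² :- U²) := t :* (H :- H²) :- (E² :- U²)) refl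
           t ((ν - E) * (ν - E)) (E * E) (ν - E - (E - U²)) U² ⟩
    t * ((ν - E) * (ν - E) - (ν - E - (E - U²))) - (E * E - U²)  ∎
    where
    p : Fin n → Fin n → Carrier
    p i j = t * (h i * h j) - u i * u j
    full : ∑∑ p ≈ t * ((ν - E) * (ν - E)) - E * E
    full = begin
      ∑∑ p
        ≈⟨ ∑∑-sub (λ i j → t * (h i * h j)) (λ i j → u i * u j) ⟩
      ∑∑ (λ i j → t * (h i * h j)) - ∑∑ (λ i j → u i * u j)
        ≈⟨ +-cong (trans (sum-cong-≋ (λ i → sym (*-distribˡ-sum t (λ j → h i * h j))))
                         (sym (*-distribˡ-sum t (λ i → sum (λ j → h i * h j)))))
                  (-‿cong (sum-product u u)) ⟩
      t * ∑∑ (λ i j → h i * h j) - E * E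
        ≈⟨ +-congʳ (*-congˡ (trans (sum-product h h) (*-cong sum-h sum-h))) ⟩
      t * ((ν - E) * (ν - E)) - E * E  ∎
    diagonal : ∑∑ (λ i j → δ i j * p i j) ≈ t * (ν - E - (E - U²)) - U²
    diagonal = begin
      ∑∑ (λ i j → δ i j * p i j)
        ≈⟨ sum-cong-≋ (λ i → sum-δ i (p i)) ⟩
      sum (λ i → t * (h i * h i) - u i * u i)
        ≈⟨ sum-sub (λ i → t * (h i * h i)) (λ i → u i * u i) ⟩
      sum (λ i → t * (h i * h i)) - U²
        ≈⟨ +-congʳ (trans (sym (*-distribˡ-sum t (λ i → h i * h i))) (*-congˡ sum-h²)) ⟩
      t * (ν - E - (E - U²)) - U²  ∎

  divergence : Carrier
  divergence = sum (λ k → D k (h k * G))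

  -- The factor t turns the b-term y_k h_k into `u k`, and thereby its sum into E.
  t*divergence : t * divergence ≈ (b * E + a * (t * (ν - E)) - c * ∑∑ pair) * G
  t*divergence = begin
    t * divergence
      ≈⟨ *-distribˡ-sum t (λ k → D k (h k * G)) ⟩
    sum (λ k → t * D k (h k * G))
      ≈⟨ sum-cong-≋ term ⟩
    sum (λ k → (b * u k + a * (t * h k) - c * sum (pair k)) * G)
      ≈⟨ *-distribʳ-sum G (λ k → b * u k + a * (t * h k) - c * sum (pair k)) ⟨
    sum (λ k → b * u k + a * (t * h k) - c * sum (pair k)) * G
      ≈⟨ *-congʳ (trans (sum-sub (λ k → b * u k + a * (t * h k)) (λ k → c * sum (pair k)))
           (+-cong (trans (∑-distrib-+ (λ k → b * u k) (λ k → a * (t * h k)))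
                     (+-cong (sym (*-distribˡ-sum b u))
                       (trans (sym (*-distribˡ-sum a (λ k → t * h k)))
                         (*-congˡ (trans (sym (*-distribˡ-sum t h)) (*-congˡ sum-h))))))
                   (-‿cong (sym (*-distribˡ-sum c (λ k → sum (pair k))))))) ⟩
    (b * E + a * (t * (ν - E)) - c * ∑∑ pair) * G  ∎
    where
    term : ∀ k → t * D k (h k * G) ≈ (b * u k + a * (t * h k) - c * sum (pair k)) * G
    term k = begin
      t * D k (h k * G)
        ≈⟨ *-congˡ (log-hG k) ⟩
      t * (ℓ k * (h k * G))
        ≈⟨ solve 9 (λ t b a c y x s h g →
             t :* ((b :* y :+ a :- c :* (x :* s)) :* (h :* g)) :=
             (b :* (t :* y :* h) :+ a :* (t :* h) :- c :* (t :* (h :* (x :* s)))) :* g) refl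
             t b a c (Y k) (X k) (sum (Q k)) (h k) G ⟩
      (b * u k + a * (t * h k) - c * (t * (h k * (X k * sum (Q k))))) * G
        ≈⟨ *-congʳ (+-congˡ (-‿cong (*-congˡ (*-congˡ (*-congˡ (*-distribˡ-sum (X k) (Q k))))))) ⟩
      (b * u k + a * (t * h k) - c * (t * (h k * sum (λ j → X k * Q k j)))) * G
        ≈⟨ *-congʳ (+-congˡ (-‿cong (*-congˡ (trans (*-congˡ (*-distribˡ-sum (h k) (λ j → X k * Q k j)))
             (*-distribˡ-sum t (λ j → h k * (X k * Q k j))))))) ⟩
      (b * u k + a * (t * h k) - c * sum (pair k)) * G  ∎

  -- The right side is a linear combination of G, T G, T (T G) and their multiples by t with integer
  -- coefficients, which is the form an additive functional can evaluate term by term.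
  aomoto : ⟦ + 2 ⟧ᶻ * (t * divergence) ≈
    ⟦ + 2 ⟧ᶻ * (b * T G) + ⟦ + 2 ⟧ᶻ * (a * (ν * (t * G) - t * T G))
      - c * (ν * (ν * (t * G)) - ν * (t * G) - ⟦ + 2 ⟧ᶻ * (ν * (t * T G) - t * T G)
             + (t * T (T G) - t * T G) - (T (T G) - T G))
  aomoto = begin
    ⟦ + 2 ⟧ᶻ * (t * divergence)
      ≈⟨ *-congˡ t*divergence ⟩
    ⟦ + 2 ⟧ᶻ * ((b * E + a * (t * (ν - E)) - c * ∑∑ pair) * G)
      ≈⟨ solve 8 (λ b e a t v c s g →
           con (+ 2) :* ((b :* e :+ a :* (t :* (v :- e)) :- c :* s) :* g) :=
           con (+ 2) :* (b :* (e :* g)) :+ con (+ 2) :* (a :* (v :* (t :* g) :- t :* (e :* g))) :- c :* (con (+ 2) :* s) :* g) refl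
           b E a t ν c (∑∑ pair) G ⟩
    ⟦ + 2 ⟧ᶻ * (b * (E * G)) + ⟦ + 2 ⟧ᶻ * (a * (ν * (t * G) - t * (E * G))) - c * (⟦ + 2 ⟧ᶻ * ∑∑ pair) * G
      ≈⟨ +-congˡ (-‿cong (*-congʳ (*-congˡ sum-pairs))) ⟩
    ⟦ + 2 ⟧ᶻ * (b * (E * G)) + ⟦ + 2 ⟧ᶻ * (a * (ν * (t * G) - t * (E * G)))
      - c * (t * ((ν - E) * (ν - E) - (ν - E - (E - U²))) - (E * E - U²)) * G
      -- `E * E - U²`, the sum of `u i * u j` over ordered pairs of distinct indices, acts on G as T
      -- T - T.
      ≈⟨ solve 8 (λ b e a t v c s g →
           con (+ 2) :* (b :* (e :* g)) :+ con (+ 2) :* (a :* (v :* (t :* g) :- t :* (e :* g)))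
             :- c :* (t :* ((v :- e) :* (v :- e) :- (v :- e :- (e :- s))) :- (e :* e :- s)) :* g :=
           con (+ 2) :* (b :* (e :* g)) :+ con (+ 2) :* (a :* (v :* (t :* g) :- t :* (e :* g)))
             :- c :* (v :* (v :* (t :* g)) :- v :* (t :* g) :- con (+ 2) :* (v :* (t :* (e :* g)) :- t :* (e :* g))
               :+ (t :* ((e :- s :+ e :* e) :* g) :- t :* (e :* g)) :- ((e :- s :+ e :* e) :* g :- e :* g))) refl
           b E a t ν c U² G ⟩
    rhs (E * G) ((E - U² + E * E) * G)
      ≈⟨ rhs-cong (sym log-G) (sym TT-G) ⟩
    rhs (T G) (T (T G))  ∎
    where
    rhs : Carrier → Carrier → Carrier
    rhs p r = ⟦ + 2 ⟧ᶻ * (b * p) + ⟦ + 2 ⟧ᶻ * (a * (ν * (t * G) - t * p))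
      - c * (ν * (ν * (t * G)) - ν * (t * G) - ⟦ + 2 ⟧ᶻ * (ν * (t * p) - t * p)
             + (t * r - t * p) - (r - p))
    rhs-cong : ∀ {p p′ r r′} → p ≈ p′ → r ≈ r′ → rhs p r ≈ rhs p′ r′
    rhs-cong p≈ r≈ = +-cong
      (+-cong (*-congˡ (*-congˡ p≈)) (*-congˡ (*-congˡ (+-congˡ (-‿cong (*-congˡ p≈))))))
      (-‿cong (*-congˡ (+-cong (+-cong
        (+-congˡ (-‿cong (*-congˡ (+-cong (*-congˡ (*-congˡ p≈)) (-‿cong (*-congˡ p≈))))))
        (+-cong (*-congˡ r≈) (-‿cong (*-congˡ p≈))))
        (-‿cong (+-cong r≈ (-‿cong p≈))))))

-- Λ and Λ′ stand for the functionals X ↦ CT [t^k] X and X ↦ CT [t^(k+1)] X.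
module Extraction (R S A : CommutativeRing 0ℓ 0ℓ) {n : ℕ} (aomotoData : AomotoData R S n) where
  open AomotoData aomotoData using (t; T; α; β; γ)
  private
    module S = CommutativeRing S
    open Aomoto R S aomotoData using (G; divergence; aomoto)
  open CommutativeRing A hiding (zero)
  open IntegerSolver A using (solve; _:=_; _:+_; _:*_; _:-_; :-_; con; ⟦_⟧ᶻ)
  open import Algebra.Properties.Semiring.Mult.TCOptimised semiring using (1+×)
  open import Relation.Binary.Reasoning.Setoid setoid

  module _ (k : ℕ) {Λ Λ′ : S.Carrier → Carrier}
    (Λ-isAdditive  : IsAdditive S A Λ)  (Λ-T  : ∀ s → Λ  (T s) ≈ ⟦ + k ⟧ᶻ * Λ s)
    (Λ′-isAdditive : IsAdditive S A Λ′) (Λ′-T : ∀ s → Λ′ (T s) ≈ ⟦ + suc k ⟧ᶻ * Λ′ s)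
    (Λ′-t : ∀ s → Λ′ (t S.* s) ≈ Λ s)
    (Λ-divergence : Λ divergence ≈ 0#)
    where
    private
      module Λ′ = IsAdditive Λ′-isAdditive
      κ κ′ ν ψ ψ′ b a c : Carrier
      κ  = ⟦ + k ⟧ᶻ
      κ′ = 1# + κ
      ν  = ⟦ + n ⟧ᶻ
      ψ  = Λ G
      ψ′ = Λ′ G
      b  = ⟦ β ⟧ᶻ
      a  = ⟦ α ⟧ᶻ
      c  = ⟦ γ ⟧ᶻ

    Λ′T : ∀ s → Λ′ (T s) ≈ κ′ * Λ′ s
    Λ′T s = trans (Λ′-T s) (*-congʳ (1+× k 1#))

    ΛTG : Λ′ (t S.* T G) ≈ κ * ψ
    ΛTG = trans (Λ′-t (T G)) (Λ-T G)

    infixl 6 _⟨-⟩_ _⟨+⟩_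
    _⟨-⟩_ : ∀ {s u p r} → Λ′ s ≈ p → Λ′ u ≈ r → Λ′ (s S.- u) ≈ p - r
    p ⟨-⟩ r = trans (Λ′.sub-homo _ _) (+-cong p (-‿cong r))

    _⟨+⟩_ : ∀ {s u p r} → Λ′ s ≈ p → Λ′ u ≈ r → Λ′ (s S.+ u) ≈ p + r
    p ⟨+⟩ r = trans (Λ′.+-homo _ _) (+-cong p r)

    scale : ∀ m {s p} → Λ′ s ≈ p → Λ′ (IntegerSolver.⟦_⟧ᶻ S m S.* s) ≈ ⟦ m ⟧ᶻ * p
    scale m {s} eq = trans (Λ′.⟦⟧-homo m s) (*-congˡ eq)

    -- This is `aomoto` under `Λ′`. A term with a factor t is read by `Λ`, where each T counts k; a
    -- term without it stays with `Λ′`, where each T counts k + 1.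
    extracted : ⟦ + 2 ⟧ᶻ * (b * (κ′ * ψ′)) + ⟦ + 2 ⟧ᶻ * (a * (ν * ψ - κ * ψ))
      - c * (ν * (ν * ψ) - ν * ψ - ⟦ + 2 ⟧ᶻ * (ν * (κ * ψ) - κ * ψ)
             + (κ * (κ * ψ) - κ * ψ) - (κ′ * (κ′ * ψ′) - κ′ * ψ′)) ≈ 0#
    extracted = begin
      _ ≈⟨ scale (+ 2) (scale β (Λ′T G)) ⟨+⟩ scale (+ 2) (scale α (scale (+ n) (Λ′-t G) ⟨-⟩ ΛTG))
           ⟨-⟩ scale γ (scale (+ n) (scale (+ n) (Λ′-t G)) ⟨-⟩ scale (+ n) (Λ′-t G)
                        ⟨-⟩ scale (+ 2) (scale (+ n) ΛTG ⟨-⟩ ΛTG)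
                        ⟨+⟩ (trans (Λ′-t (T (T G))) (trans (Λ-T (T G)) (*-congˡ (Λ-T G))) ⟨-⟩ ΛTG)
                        ⟨-⟩ (trans (Λ′T (T G)) (*-congˡ (Λ′T G)) ⟨-⟩ Λ′T G)) ⟨
      Λ′ _ ≈⟨ Λ′.cong aomoto ⟨
      Λ′ (IntegerSolver.⟦_⟧ᶻ S (+ 2) S.* (t S.* divergence))
        ≈⟨ scale (+ 2) (trans (Λ′-t divergence) Λ-divergence) ⟩
      ⟦ + 2 ⟧ᶻ * 0#
        ≈⟨ zeroʳ _ ⟩
      0#  ∎

    -- In `extracted` the coefficient of - c ψ factors as (ν - κ) (ν - κ - 1) and that of c ψ′ as κ′
    -- κ. Hence κ′ comes out of everything at ψ′, ν - κ out of everything at ψ, and halving leaves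
    -- c/2.
    recurrence : ∀ {half} → ⟦ + 2 ⟧ᶻ * half ≈ 1# →
      κ′ * ((b + κ * (c * half)) * ψ′) ≈ (ν - κ) * ((- a + (ν - κ′) * (c * half)) * ψ)
    recurrence {half} 2*half≈1 = begin
      κ′ * ((b + κ * (c * half)) * ψ′)
        -- `z` is the left side of `extracted`. Adding `e * z` and a multiple of 1 - 2 e, both of
        -- which vanish, makes the equation a polynomial identity.
        ≈⟨ solve 8 (λ k n b a c e p p′ →
             let k′ = con 1ℤ :+ k
                 z  = con (+ 2) :* (b :* (k′ :* p′)) :+ con (+ 2) :* (a :* (n :* p :- k :* p))
                      :- c :* (n :* (n :* p) :- n :* p :- con (+ 2) :* (n :* (k :* p) :- k :* p)
                      :+ (k :* (k :* p) :- k :* p) :- (k′ :* (k′ :* p′) :- k′ :* p′))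
             in k′ :* ((b :+ k :* (c :* e)) :* p′) :=
                (n :- k) :* ((:- a :+ (n :- k′) :* (c :* e)) :* p)
                  :+ (e :* z :+ (con 1ℤ :- con (+ 2) :* e) :* (k′ :* (b :* p′) :+ a :* ((n :- k) :* p)))) refl
             κ ν b a c half ψ ψ′ ⟩
      (ν - κ) * ((- a + (ν - κ′) * (c * half)) * ψ)
        + (half * _ + (1# - ⟦ + 2 ⟧ᶻ * half) * (κ′ * (b * ψ′) + a * ((ν - κ) * ψ)))
        ≈⟨ +-congˡ (+-cong (*-congˡ extracted) (*-congʳ (trans (+-congˡ (-‿cong 2*half≈1)) (-‿inverseʳ 1#)))) ⟩
      (ν - κ) * ((- a + (ν - κ′) * (c * half)) * ψ) + (half * 0# + 0# * (κ′ * (b * ψ′) + a * ((ν - κ) * ψ)))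
        ≈⟨ trans (+-congˡ (trans (+-cong (zeroʳ _) (zeroˡ _)) (+-identityʳ 0#))) (+-identityʳ _) ⟩
      (ν - κ) * ((- a + (ν - κ′) * (c * half)) * ψ)  ∎

-- Extraction of the constant term

module ConstantCoefficient (R : CommutativeRing 0ℓ 0ℓ) where
  open CommutativeRing R hiding (zero; _*_)
  private module R = CommutativeRing R
  open LaurentRing R
  open LaurentDerivations R
  open import Relation.Binary.Reasoning.Setoid setoid
  private
    module R× where open import Algebra.Definitions.RawSemiring (RawRing.rawSemiring rawRing) public
    module 𝕃× where open import Algebra.Definitions.RawSemiring 𝕃.rawSemiring public

  -- s is a power series with constant coefficient r.
  record HasConstant (s : Laurent Carrier) (r : Carrier) : Set where
    constructor _,_
    field
      ord≡0   : ord s ≡ 0ℤ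
      coeff≈r : coeffs s 0 ≈ r

  coeff-HasConstant : ∀ {s r} → HasConstant s r → [ 0ℤ ] s ≈ r
  coeff-HasConstant {⟨ _ , _ ⟩} (≡.refl , p) = p

  constant-* : ∀ {s u p r} → HasConstant s p → HasConstant u r → HasConstant (s 𝕃.* u) (p R.* r)
  constant-* (ord-s , p) (ord-u , r) =
    ≡.cong₂ ℤ._+_ ord-s ord-u , trans (+-identityʳ _) (*-cong p r)

  constant-ι : ∀ r → HasConstant (ι r) r
  constant-ι r = ≡.refl , refl

  constant-1+t : ∀ r → HasConstant (𝕃.1# 𝕃.+ monomial rawRing 1ℤ 𝕃.* ι r) 1#
  constant-1+t r = ≡.refl , +-identityʳ 1#

  constant-product : ∀ {m} (s : Fin m → Laurent Carrier) (r : Fin m → Carrier) →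
    (∀ i → HasConstant (s i) (r i)) → HasConstant (𝕃×.product s) (R×.product r)
  constant-product {zero}  s r p = ≡.refl , refl
  constant-product {suc m} s r p =
    constant-* (p zero) (constant-product (s ∘ suc) (r ∘ suc) (p ∘ suc))

  constant-integrand : ∀ {m} (v y : Fin m → Carrier) e →
    [ 0ℤ ] (𝕃×.product (λ i → ι (v i) 𝕃.* (𝕃.1# 𝕃.+ monomial rawRing 1ℤ 𝕃.* ι (y i))) 𝕃.* ι e)
      ≈ R×.product v R.* e
  constant-integrand v y e = trans
    (coeff-HasConstant (constant-*
      (constant-product _ (λ i → v i R.* 1#) (λ i → constant-* (constant-ι (v i)) (constant-1+t (y i))))
      (constant-ι e)))
    (*-congʳ (product-cong (λ i → *-identityʳ (v i))))
    where open import Algebra.Properties.CommutativeMonoid.Sum *-commutativeMonoid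
            using () renaming (sum-cong-≋ to product-cong)

open import Data.Rational.Base using (_*_)

-- On power series in t the constant coefficient is multiplicative, and it sends each factor 1 + t
-- y_i to 1.
Ψ-0 : ∀ n a b c → Ψ n 0 a b c ≡ M n a b c
Ψ-0 n a b c = IsAdditive.cong (CT-isAdditive n)
  (ConstantCoefficient.constant-integrand (seriesRing n) (vertexFactor n a b) (x/[1-x] n) (edgeProduct n c))

-- The concrete data and the recurrence for Ψ

module PsiRecurrence (n a b c : ℕ) where
  private
    R = seriesRing n
    module R = 𝕊 n
    open Integrand n a b c
    open LaurentDerivations R
    open MonomialsAndConstants R
    S = laurentCommutativeRing
    module S where
      open CommutativeRing S public
      open IntegerSolver S public

    t : Laurent R.Carrier
    t = monomial R.rawRing 1ℤ

    h : Fin n → Laurent R.Carrier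
    h i = ⟨ 0ℤ , (λ m → pow m) ⟩
      where
      pow : ℕ → R.Carrier
      pow zero    = R.1#
      pow (suc m) = R.- y i R.* pow m

    h-inverse : ∀ i → (S.1# S.+ t S.* ι (y i)) S.* h i S.≈ S.1#
    h-inverse i = S.trans {(S.1# S.+ t S.* ι (y i)) S.* h i} {(S.1# S.- t S.* ι (R.- y i)) S.* h i} {S.1#}
      (S.*-congʳ {h i} {S.1# S.+ t S.* ι (y i)} {S.1# S.- t S.* ι (R.- y i)}
        (S.trans {S.1# S.+ t S.* ι (y i)} {S.1# S.- t S.* (S.- ι (y i))} {S.1# S.- t S.* ι (R.- y i)}
          (S.solve 2 (λ t y → S.con 1ℤ S.:+ t S.:* y S.:= S.con 1ℤ S.:- t S.:* (S.:- y)) (λ _ → R.refl) t (ι (y i)))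
          (S.+-congˡ {S.1#} {S.- (t S.* (S.- ι (y i)))} {S.- (t S.* ι (R.- y i))}
            (S.-‿cong {t S.* (S.- ι (y i))} {t S.* ι (R.- y i)}
              (S.*-congˡ {t} {S.- ι (y i)} {ι (R.- y i)}
                (S.sym {ι (R.- y i)} {S.- ι (y i)} (IsAdditive.-‿homo ι-isAdditive (y i))))))))
      (geometric (R.- y i) (coeffs (h i)) R.refl (λ _ → R.refl))

    -- As t is the outermost variable, t ∂/∂t is `euler`, while x_k ∂/∂x_k acts on each coefficient
    -- of a power of t and annihilates t.
    aomotoData : AomotoData R S n
    aomotoData = record
      { φ = ι ; φ-isAdditive = ι-isAdditive ; φ-* = ι-* ; φ-1 = λ _ → R.refl
      ; D₀ = θ
      ; D = λ k → gradedMap (λ _ → θ k)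
      ; D-isDerivation = λ k → Coefficientwise.coeffwise-isDerivation (θ-isDerivation k)
      ; D-φ = λ k → coeffwise-ι (θ-isDerivation k)
      ; T = euler ; T-isDerivation = euler-isDerivation ; T-φ = euler-ι
      ; t = t
      ; D-t = λ k → coeffwise-monomial (θ-isDerivation k) 1ℤ
      ; T-t = S.trans {euler t} {S.⟦ 1ℤ ⟧ᶻ S.* t} {t} (euler-monomial 1ℤ) (S.*-identityˡ t)
      ; x = x ; y = y ; y≈x+yx = y≈x+yx ; D₀-y = θ-y
      ; q = q ; q-antisym = q-antisym ; q-inverse = q-inverse
      ; h = h ; h-inverse = h-inverse
      ; β = + b ; α = ℤ.- + a ℤ.+ 1ℤ ; γ = + c
      ; F = F ; log-F = log-F
      }

    module A = Aomoto R S aomotoData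
    module ℚᶻ = IntegerSolver (seriesRing 0)

    Λ : ℕ → Laurent R.Carrier → ℚ
    Λ k s = CT n (coeff (L n) (+ k) s)

    module CTₙ = IsAdditive (CT-isAdditive n)

    Λ-isAdditive : ∀ k → IsAdditive S (seriesRing 0) (Λ k)
    Λ-isAdditive k = record
      { cong = λ p → CTₙ.cong (p (+ k))
      ; +-homo = λ s u → ≡.trans (CTₙ.cong (LaurentRing.coeff-+ R (+ k) s u)) (CTₙ.+-homo _ _) }

    Λ-euler : ∀ k s → Λ k (euler s) ≡ ℚᶻ.⟦ + k ⟧ᶻ * Λ k s
    Λ-euler k s = ≡.trans (CTₙ.cong (coeff-euler (+ k) s)) (CTₙ.⟦⟧-homo (+ k) (coeff (L n) (+ k) s))

    Λ-t : ∀ k s → Λ (suc k) (t S.* s) ≡ Λ k s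
    Λ-t k s = CTₙ.cong (coeff-monomial-* (+ suc k) 1ℤ s)

    Λ-divergence : ∀ k → Λ k A.divergence ≡ 0ℚ
    Λ-divergence k = ≡.trans (IsAdditive.sum-homo (Λ-isAdditive k) D[hG])
      (FiniteSums.sum-zero (seriesRing 0) (λ i → Λ k (D[hG] i)) λ i →
        ≡.trans (CTₙ.cong (Coefficientwise.coeff-coeffwise (θ-isDerivation i) (+ k) (h i S.* A.G)))
          (CT-θ i (coeff (L n) (+ k) (h i S.* A.G))))
      where
      D[hG] : Fin n → Laurent R.Carrier
      D[hG] i = gradedMap (λ _ → θ i) (h i S.* A.G)

    Ψ≡Λ : ∀ k → Ψ n k a b c ≡ Λ k A.G
    Ψ≡Λ k = CTₙ.cong (A.integrand≈G (vertexFactor n a b) (edgeProduct n c) ≡.refl (+ k))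

    2*½≡1 : ℚᶻ.⟦ + 2 ⟧ᶻ * ½ ≡ 1ℚ
    2*½≡1 = ≡.refl

  Recurrence : ℕ → ℚ → ℚ → Set
  Recurrence k ψ ψ′ =
    (1ℚ ℚ.+ ⟦ + k ⟧ᶻ) * ((⟦ + b ⟧ᶻ ℚ.+ ⟦ + k ⟧ᶻ * (⟦ + c ⟧ᶻ * ½)) * ψ′) ≡
    (⟦ + n ⟧ᶻ ℚ.- ⟦ + k ⟧ᶻ) *
      ((ℚ.- ⟦ ℤ.- + a ℤ.+ 1ℤ ⟧ᶻ ℚ.+ (⟦ + n ⟧ᶻ ℚ.- (1ℚ ℚ.+ ⟦ + k ⟧ᶻ)) * (⟦ + c ⟧ᶻ * ½)) * ψ)
    where open IntegerSolver (seriesRing 0) using (⟦_⟧ᶻ)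

  Ψ-recurrence : ∀ k → Recurrence k (Ψ n k a b c) (Ψ n (suc k) a b c)
  Ψ-recurrence k = ≡.subst₂ (Recurrence k) (≡.sym (Ψ≡Λ k)) (≡.sym (Ψ≡Λ (suc k)))
    (Extraction.recurrence R S (seriesRing 0) aomotoData k
      (Λ-isAdditive k) (Λ-euler k) (Λ-isAdditive (suc k)) (Λ-euler (suc k)) (Λ-t k) (Λ-divergence k) {½} 2*½≡1)

-- Binomial coefficients, rational arithmetic and the closed form

nC0≡1 : ∀ n → n C 0 ≡ 1
nC0≡1 n = ≡.trans (nCk≡nC[n∸k] {0} {n} z≤n) (nCn≡1 n)

-- This is (k + 1) C(n, k + 1) = (n - k) C(n, k) with the subtracted term moved across, which avoids
-- truncated subtraction in ℕ.
[k+1]*nC[k+1]+k*nCk≡n*nCk : ∀ n k → suc k ℕ.* (n C suc k) ℕ.+ k ℕ.* (n C k) ≡ n ℕ.* (n C k)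
[k+1]*nC[k+1]+k*nCk≡n*nCk zero    zero    = ≡.refl
[k+1]*nC[k+1]+k*nCk≡n*nCk zero    (suc k) = ≡.cong₂ ℕ._+_ (ℕₚ.*-zeroʳ k) (ℕₚ.*-zeroʳ k)
[k+1]*nC[k+1]+k*nCk≡n*nCk (suc n) zero    = begin
  1 ℕ.* (suc n C 1) ℕ.+ 0  ≡⟨ ≡.trans (ℕₚ.+-identityʳ _) (ℕₚ.*-identityˡ _) ⟩
  suc n C 1                ≡⟨ nC1≡n (suc n) ⟩
  suc n                    ≡⟨ ℕₚ.*-identityʳ (suc n) ⟨
  suc n ℕ.* 1              ≡⟨ ≡.cong (suc n ℕ.*_) (nC0≡1 (suc n)) ⟨
  suc n ℕ.* (suc n C 0)    ∎
  where open ≡.≡-Reasoning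
[k+1]*nC[k+1]+k*nCk≡n*nCk (suc n) (suc k) = begin
  (2 ℕ.+ k) ℕ.* (suc n C (2 ℕ.+ k)) ℕ.+ suc k ℕ.* (suc n C suc k)
    ≡⟨ ≡.cong₂ (λ p q → (2 ℕ.+ k) ℕ.* p ℕ.+ suc k ℕ.* q) (nCk+nC[k+1]≡[n+1]C[k+1] n (suc k)) (nCk+nC[k+1]≡[n+1]C[k+1] n k) ⟨
  (2 ℕ.+ k) ℕ.* (B ℕ.+ D) ℕ.+ suc k ℕ.* (A ℕ.+ B)
    -- After Pascal's rule the terms are grouped into the left sides of the induction hypotheses at
    -- k + 1 and at k, with A + B left over; the remainder raises the factor n to n + 1.
    ≡⟨ solve 4 (λ k A B D →
         (con 2 :+ k) :* (B :+ D) :+ (con 1 :+ k) :* (A :+ B) :=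
         (((con 2 :+ k) :* D :+ (con 1 :+ k) :* B) :+ ((con 1 :+ k) :* B :+ k :* A)) :+ (A :+ B)) ≡.refl k A B D ⟩
  ((2 ℕ.+ k) ℕ.* D ℕ.+ suc k ℕ.* B) ℕ.+ (suc k ℕ.* B ℕ.+ k ℕ.* A) ℕ.+ (A ℕ.+ B)
    ≡⟨ ≡.cong₂ (λ p q → p ℕ.+ q ℕ.+ (A ℕ.+ B)) ([k+1]*nC[k+1]+k*nCk≡n*nCk n (suc k)) ([k+1]*nC[k+1]+k*nCk≡n*nCk n k) ⟩
  n ℕ.* B ℕ.+ n ℕ.* A ℕ.+ (A ℕ.+ B)
    ≡⟨ solve 3 (λ n A B → n :* B :+ n :* A :+ (A :+ B) := (con 1 :+ n) :* (A :+ B)) ≡.refl n A B ⟩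
  suc n ℕ.* (A ℕ.+ B)
    ≡⟨ ≡.cong (suc n ℕ.*_) (nCk+nC[k+1]≡[n+1]C[k+1] n k) ⟩
  suc n ℕ.* (suc n C suc k)  ∎
  where
  open ≡.≡-Reasoning
  open ℕSolver.+-*-Solver
  A = n C k
  B = n C suc k
  D = n C (2 ℕ.+ k)

private
  module ℚᶻ = IntegerSolver (seriesRing 0)
  open ℚᶻ using (⟦_⟧ᶻ; ⟦+⟧; ⟦-⟧; ⟦*⟧; solve; _:=_; _:+_; _:*_; _:-_; :-_; con)
  open import Algebra.Properties.Semiring.Mult.TCOptimised (CommutativeRing.semiring (seriesRing 0)) using (1+×)

-- `fromℕ` normalises its fraction and so does not compute at a variable m; the comparison is made
-- among unnormalised fractions, where it is an integer identity.
fromℕ-suc : ∀ m → fromℕ (suc m) ≡ 1ℚ ℚ.+ fromℕ m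
fromℕ-suc m = ℚₚ.toℚᵘ-injective (begin
  ℚ.toℚᵘ (fromℕ (suc m))             ≈⟨ ℚₚ.toℚᵘ-fromℚᵘ (ℚᵘ.mkℚᵘ (+ suc m) 0) ⟩
  ℚᵘ.mkℚᵘ (+ suc m) 0                ≈⟨ ℚᵘ.*≡* (ℤS.solve 1 (λ i →
    (ℤS.con 1ℤ ℤS.:+ i) ℤS.:* ℤS.con 1ℤ ℤS.:= (ℤS.con 1ℤ ℤS.:+ i ℤS.:* ℤS.con 1ℤ) ℤS.:* ℤS.con 1ℤ) ≡.refl (+ m)) ⟩
  ℚᵘ.1ℚᵘ ℚᵘ.+ ℚᵘ.mkℚᵘ (+ m) 0        ≈⟨ ℚᵘₚ.+-congʳ ℚᵘ.1ℚᵘ (ℚₚ.toℚᵘ-fromℚᵘ (ℚᵘ.mkℚᵘ (+ m) 0)) ⟨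
  ℚᵘ.1ℚᵘ ℚᵘ.+ ℚ.toℚᵘ (fromℕ m)       ≈⟨ ℚₚ.toℚᵘ-homo-+ 1ℚ (fromℕ m) ⟨
  ℚ.toℚᵘ (1ℚ ℚ.+ fromℕ m)            ∎)
  where
  open import Relation.Binary.Reasoning.Setoid ℚᵘₚ.≃-setoid
  module ℤS = ℤSolver.+-*-Solver

⟦⟧≡fromℕ : ∀ m → ⟦ + m ⟧ᶻ ≡ fromℕ m
⟦⟧≡fromℕ zero    = ≡.refl
⟦⟧≡fromℕ (suc m) = ≡.trans (1+× m 1ℚ) (≡.trans (≡.cong (1ℚ ℚ.+_) (⟦⟧≡fromℕ m)) (≡.sym (fromℕ-suc m)))

binomial-step : ∀ n k → fromℕ (suc k) * fromℕ (n C suc k) ≡ (fromℕ n ℚ.- fromℕ k) * fromℕ (n C k)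
binomial-step n k = begin
  fromℕ (suc k) * fromℕ C′
    ≡⟨ solve 3 (λ p q c → p := p :+ q :* c :- q :* c) ≡.refl (fromℕ (suc k) * fromℕ C′) (fromℕ k) (fromℕ C₀) ⟩
  fromℕ (suc k) * fromℕ C′ ℚ.+ fromℕ k * fromℕ C₀ ℚ.- fromℕ k * fromℕ C₀
    ≡⟨ ≡.cong (ℚ._- (fromℕ k * fromℕ C₀)) cast ⟩
  fromℕ n * fromℕ C₀ ℚ.- fromℕ k * fromℕ C₀
    ≡⟨ solve 3 (λ n k c → n :* c :- k :* c := (n :- k) :* c) ≡.refl (fromℕ n) (fromℕ k) (fromℕ C₀) ⟩
  (fromℕ n ℚ.- fromℕ k) * fromℕ C₀  ∎
  where
  open ≡.≡-Reasoning
  C₀ C′ : ℕ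
  C₀ = n C k
  C′ = n C suc k
  fromℕ-* : ∀ p q → fromℕ (p ℕ.* q) ≡ fromℕ p * fromℕ q
  fromℕ-* p q = begin
    fromℕ (p ℕ.* q)        ≡⟨ ⟦⟧≡fromℕ (p ℕ.* q) ⟨
    ⟦ + (p ℕ.* q) ⟧ᶻ       ≡⟨ ≡.cong ⟦_⟧ᶻ (ℤₚ.pos-* p q) ⟩
    ⟦ + p ℤ.* + q ⟧ᶻ       ≡⟨ ⟦*⟧ (+ p) (+ q) ⟩
    ⟦ + p ⟧ᶻ * ⟦ + q ⟧ᶻ    ≡⟨ ≡.cong₂ _*_ (⟦⟧≡fromℕ p) (⟦⟧≡fromℕ q) ⟩
    fromℕ p * fromℕ q      ∎
  fromℕ-+ : ∀ p q → fromℕ (p ℕ.+ q) ≡ fromℕ p ℚ.+ fromℕ q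
  fromℕ-+ p q = begin
    fromℕ (p ℕ.+ q)            ≡⟨ ⟦⟧≡fromℕ (p ℕ.+ q) ⟨
    ⟦ + p ℤ.+ + q ⟧ᶻ           ≡⟨ ⟦+⟧ (+ p) (+ q) ⟩
    ⟦ + p ⟧ᶻ ℚ.+ ⟦ + q ⟧ᶻ      ≡⟨ ≡.cong₂ ℚ._+_ (⟦⟧≡fromℕ p) (⟦⟧≡fromℕ q) ⟩
    fromℕ p ℚ.+ fromℕ q        ∎
  cast : fromℕ (suc k) * fromℕ C′ ℚ.+ fromℕ k * fromℕ C₀ ≡ fromℕ n * fromℕ C₀
  cast = begin
    fromℕ (suc k) * fromℕ C′ ℚ.+ fromℕ k * fromℕ C₀    ≡⟨ ≡.cong₂ ℚ._+_ (fromℕ-* (suc k) C′) (fromℕ-* k C₀) ⟨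
    fromℕ (suc k ℕ.* C′) ℚ.+ fromℕ (k ℕ.* C₀)          ≡⟨ fromℕ-+ (suc k ℕ.* C′) (k ℕ.* C₀) ⟨
    fromℕ (suc k ℕ.* C′ ℕ.+ k ℕ.* C₀)                  ≡⟨ ≡.cong fromℕ ([k+1]*nC[k+1]+k*nCk≡n*nCk n k) ⟩
    fromℕ (n ℕ.* C₀)                                   ≡⟨ fromℕ-* n C₀ ⟩
    fromℕ n * fromℕ C₀                                 ∎

*-cancelˡ-nonZero : ∀ r {p q} .{{_ : ℚ.NonZero r}} → r * p ≡ r * q → p ≡ q
*-cancelˡ-nonZero r {p} {q} rp≡rq = ≡.trans (≡.sym (strip p)) (≡.trans (≡.cong (1/ r *_) rp≡rq) (strip q))
  where
  strip : ∀ s → 1/ r * (r * s) ≡ s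
  strip s = ≡.trans (≡.sym (ℚₚ.*-assoc (1/ r) r s))
    (≡.trans (≡.cong (_* s) (ℚₚ.*-inverseˡ r)) (ℚₚ.*-identityˡ s))

*-÷ : ∀ r p .{{_ : ℚ.NonZero r}} → r * (p ÷ r) ≡ p
*-÷ r p = begin
  r * (p * 1/ r)   ≡⟨ solve 3 (λ r p i → r :* (p :* i) := p :* (r :* i)) ≡.refl r p (1/ r) ⟩
  p * (r * 1/ r)   ≡⟨ ≡.cong (p *_) (ℚₚ.*-inverseʳ r) ⟩
  p * 1ℚ           ≡⟨ ℚₚ.*-identityʳ p ⟩
  p                ∎
  where open ≡.≡-Reasoning

module _ (n a b c : ℕ) .{{_ : NonZero b}} where
  ratio : ℕ → ℚ
  ratio m = (numerator n a c (suc m) ÷ denominator b c m) {{denominator-nonZero b c m}}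

  -- `product` unfolds at the first index, whereas the step from k to k + 1 appends a factor at the
  -- last.
  ratioProduct-suc : ∀ k → ratioProduct n (suc k) a b c ≡ ratioProduct n k a b c * ratio k
  ratioProduct-suc k = ≡.trans (product-init-last {k} (ratio ∘ toℕ))
    (≡.cong₂ _*_ (product-cong {k} (λ j → ≡.cong ratio (toℕ-inject₁ j))) (≡.cong ratio (toℕ-fromℕ k)))
    where
    open import Algebra.Properties.CommutativeMonoid.Sum (CommutativeRing.*-commutativeMonoid (seriesRing 0))
      using () renaming (sum-init-last to product-init-last; sum-cong-≋ to product-cong)

  Ψ-step : ∀ k → fromℕ (suc k) * (denominator b c k * Ψ n (suc k) a b c) ≡
           (fromℕ n ℚ.- fromℕ k) * (numerator n a c (suc k) * Ψ n k a b c)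
  Ψ-step k = begin
    fromℕ (suc k) * (denominator b c k * Ψ′)
      ≡⟨ ≡.cong₂ (λ p q → p * (q * Ψ′)) suc-k den ⟨
    (1ℚ ℚ.+ ⟦ + k ⟧ᶻ) * ((⟦ + b ⟧ᶻ ℚ.+ ⟦ + k ⟧ᶻ * (⟦ + c ⟧ᶻ * ½)) * Ψ′)
      ≡⟨ PsiRecurrence.Ψ-recurrence n a b c k ⟩
    (⟦ + n ⟧ᶻ ℚ.- ⟦ + k ⟧ᶻ) *
      ((ℚ.- ⟦ ℤ.- + a ℤ.+ 1ℤ ⟧ᶻ ℚ.+ (⟦ + n ⟧ᶻ ℚ.- (1ℚ ℚ.+ ⟦ + k ⟧ᶻ)) * (⟦ + c ⟧ᶻ * ½)) * Ψ₀)
      ≡⟨ ≡.cong₂ (λ p q → p * (q * Ψ₀)) (≡.cong₂ ℚ._-_ (⟦⟧≡fromℕ n) (⟦⟧≡fromℕ k)) num ⟩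
    (fromℕ n ℚ.- fromℕ k) * (numerator n a c (suc k) * Ψ₀)  ∎
    where
    open ≡.≡-Reasoning
    Ψ₀ Ψ′ : ℚ
    Ψ₀ = Ψ n k a b c
    Ψ′ = Ψ n (suc k) a b c
    suc-k : 1ℚ ℚ.+ ⟦ + k ⟧ᶻ ≡ fromℕ (suc k)
    suc-k = ≡.trans (≡.cong (1ℚ ℚ.+_) (⟦⟧≡fromℕ k)) (≡.sym (fromℕ-suc k))
    den : ⟦ + b ⟧ᶻ ℚ.+ ⟦ + k ⟧ᶻ * (⟦ + c ⟧ᶻ * ½) ≡ denominator b c k
    den = ≡.cong₂ ℚ._+_ (⟦⟧≡fromℕ b) (≡.cong₂ _*_ (⟦⟧≡fromℕ k) (≡.cong (_* ½) (⟦⟧≡fromℕ c)))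
    1-a : ℚ.- ⟦ ℤ.- + a ℤ.+ 1ℤ ⟧ᶻ ≡ fromℕ a ℚ.- fromℕ 1
    1-a = begin
      ℚ.- ⟦ ℤ.- + a ℤ.+ 1ℤ ⟧ᶻ        ≡⟨ ≡.cong ℚ.-_ (≡.trans (⟦+⟧ (ℤ.- + a) 1ℤ) (≡.cong (ℚ._+ 1ℚ) (⟦-⟧ (+ a)))) ⟩
      ℚ.- (ℚ.- ⟦ + a ⟧ᶻ ℚ.+ 1ℚ)      ≡⟨ solve 1 (λ a → :- (:- a :+ con 1ℤ) := a :- con 1ℤ) ≡.refl ⟦ + a ⟧ᶻ ⟩
      ⟦ + a ⟧ᶻ ℚ.- 1ℚ                ≡⟨ ≡.cong (ℚ._- 1ℚ) (⟦⟧≡fromℕ a) ⟩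
      fromℕ a ℚ.- fromℕ 1            ∎
    num : ℚ.- ⟦ ℤ.- + a ℤ.+ 1ℤ ⟧ᶻ ℚ.+ (⟦ + n ⟧ᶻ ℚ.- (1ℚ ℚ.+ ⟦ + k ⟧ᶻ)) * (⟦ + c ⟧ᶻ * ½) ≡ numerator n a c (suc k)
    num = ≡.cong₂ ℚ._+_ 1-a (≡.cong₂ _*_ (≡.cong₂ ℚ._-_ (⟦⟧≡fromℕ n) suc-k) (≡.cong (_* ½) (⟦⟧≡fromℕ c)))

  -- Induction on k. The recurrence determines the next value because k + 1 and the denominator,
  -- positive as b is, can be cancelled.
  Ψ-closed : ∀ k → Ψ n k a b c ≡ fromℕ (n C k) * M n a b c * ratioProduct n k a b c
  Ψ-closed zero    = begin
    Ψ n 0 a b c                          ≡⟨ Ψ-0 n a b c ⟩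
    M n a b c                            ≡⟨ ≡.trans (ℚₚ.*-identityʳ _) (ℚₚ.*-identityˡ _) ⟨
    1ℚ * M n a b c * 1ℚ                  ≡⟨ ≡.cong (λ m → fromℕ m * M n a b c * 1ℚ) (nC0≡1 n) ⟨
    fromℕ (n C 0) * M n a b c * 1ℚ       ∎
    where open ≡.≡-Reasoning
  Ψ-closed (suc k) =
    *-cancelˡ-nonZero (denominator b c k) {{denominator-nonZero b c k}}
      (*-cancelˡ-nonZero (fromℕ (suc k)) {{ℚₚ.pos⇒nonZero (fromℕ (suc k)) {{ℚₚ.normalize-pos (suc k) 1}}}} (begin
        fromℕ (suc k) * (d * Ψ n (suc k) a b c)
          ≡⟨ Ψ-step k ⟩
        (fromℕ n ℚ.- fromℕ k) * (N * Ψ n k a b c)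
          ≡⟨ ≡.cong (λ ψ → (fromℕ n ℚ.- fromℕ k) * (N * ψ)) (Ψ-closed k) ⟩
        (fromℕ n ℚ.- fromℕ k) * (N * (fromℕ (n C k) * m * r))
          ≡⟨ solve 5 (λ e N c m r → e :* (N :* (c :* m :* r)) := (e :* c) :* (N :* (m :* r))) ≡.refl
               (fromℕ n ℚ.- fromℕ k) N (fromℕ (n C k)) m r ⟩
        (fromℕ n ℚ.- fromℕ k) * fromℕ (n C k) * (N * (m * r))
          -- The factor n - k moves the binomial coefficient from k to k + 1 and releases k + 1; the
          -- numerator splits into the denominator times the next ratio. Both released factors are
          -- those to be cancelled.
          ≡⟨ ≡.cong₂ (λ p q → p * (q * (m * r))) (≡.sym (binomial-step n k)) (≡.sym (*-÷ d N {{denominator-nonZero b c k}})) ⟩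
        fromℕ (suc k) * fromℕ (n C suc k) * (d * ratio k * (m * r))
          ≡⟨ solve 6 (λ s c d q m r → s :* c :* (d :* q :* (m :* r)) := s :* (d :* (c :* m :* (r :* q)))) ≡.refl
               (fromℕ (suc k)) (fromℕ (n C suc k)) d (ratio k) m r ⟩
        fromℕ (suc k) * (d * (fromℕ (n C suc k) * m * (r * ratio k)))
          ≡⟨ ≡.cong (λ p → fromℕ (suc k) * (d * (fromℕ (n C suc k) * m * p))) (ratioProduct-suc k) ⟨
        fromℕ (suc k) * (d * (fromℕ (n C suc k) * m * ratioProduct n (suc k) a b c))  ∎))
    where
    open ≡.≡-Reasoning
    d N m r : ℚ
    d = denominator b c k
    N = numerator n a c (suc k)
    m = M n a b c
    r = ratioProduct n k a b c

theorem1p8 : (n a b c k : ℕ) .{{_ : NonZero n}} .{{_ : NonZero a}} .{{_ : NonZero b}} → k ≤ n →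
    Ψ n k a b c ≡ fromℕ (n C k) * M n a b c * ratioProduct n k a b c
theorem1p8 n a b c k _ = Ψ-closed n a b c k
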